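{- Let $a,b\geq 1$, $m,p,q>1$ and $n\geq 4$ be integers. The graph $aH_{m,p}\boxtimes bH_{n,q}$ is distance magic if and only if $m\equiv n\equiv 0\pmod 2$ or $mnabpq\equiv 1 \pmod 2$.
   Context: A graph $G$ on $v$ vertices is distance magic if there is a bijection $f:V(G)\to\{1,\ldots,v\}$ and a constant $k$ such that for every vertex $x$, $\sum_{y\in N(x)}f(y)=k$, where $N(x)$ is the set of neighbours of $x$. $H_{n,p}$ denotes the complete multipartite graph with $p$ partite sets each of size $n$; for a positive integer $a$, $aG$ denotes the disjoint union of $a$ copies of $G$. The strong product $G\boxtimes H$ has vertex set $V(G)\times V(H)$, with $(g,h)$ adjacent to $(g',h')$ iff either $g=g'$ and $hh'\in E(H)$, or $h=h'$ and $gg'\in E(G)$, or $gg'\in E(G)$ and $hh'\in E(H)$. -}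

module Defs where

open import Data.Fin using (Fin; toℕ)
import Data.Fin.Properties as Fin
open import Data.List using (List; allFin; filter; map)
open import Data.Nat using (ℕ; suc; _*_)
open import Data.Nat.ListAction using (sum)
open import Data.Product using (_×_; _,_; ∃)
open import Data.Product.Function.NonDependent.Propositional using (_×-↔_)
open import Data.Sum using (_⊎_; inj₁; inj₂)
open import Function.Bundles using (_↔_; _⤖_; Inverse; Bijection)
open import Function.Construct.Identity using (↔-id)
open import Function.Properties.Inverse using (↔-sym; ↔-trans; ↔⇒↣)
open import Relation.Binary.Definitions using (Decidable; DecidableEquality; Irreflexive; Symmetric)
open import Relation.Binary.PropositionalEquality using (_≡_; _≢_; refl; sym)
open import Relation.Nullary.Decidable using (¬?; _×-dec_; _⊎-dec_; via-injection)

record Graph : Set₁ where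
  infix 4 _~_ _~?_ _≟_
  field
    Vertex   : Set
    order    : ℕ
    finite   : Vertex ↔ Fin order
    _~_      : Vertex → Vertex → Set
    _~?_     : Decidable _~_
    ~-sym    : Symmetric _~_
    ~-irrefl : Irreflexive _≡_ _~_

  _≟_ : DecidableEquality Vertex
  _≟_ = via-injection (↔⇒↣ finite) Fin._≟_

  vertices : List Vertex
  vertices = map (Inverse.from finite) (allFin order)

  neighbours : Vertex → List Vertex
  neighbours x = filter (x ~?_) vertices

×-finite : ∀ {A B : Set} {m n} → A ↔ Fin m → B ↔ Fin n → (A × B) ↔ Fin (m * n)
×-finite f g = ↔-trans (f ×-↔ g) (↔-sym Fin.*↔×)

-- A bijection onto {1,…,v} is given as a bijection onto Fin v = {0,…,v-1};
-- the label of a vertex is its image shifted by one.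
DistanceMagic : Graph → Set
DistanceMagic G = ∃ λ (f : Vertex ⤖ Fin order) → ∃ λ (k : ℕ) →
    ∀ x → sum (map (λ y → suc (toℕ (Bijection.to f y))) (neighbours x)) ≡ k
  where open Graph G

-- H n p has p partite sets of size n; (i , s) is the s-th vertex of the i-th one.
H : ℕ → ℕ → Graph
H n p = record
  { Vertex   = Fin p × Fin n
  ; order    = p * n
  ; finite   = ×-finite (↔-id (Fin p)) (↔-id (Fin n))
  ; _~_      = λ (i , _) (j , _) → i ≢ j
  ; _~?_     = λ (i , _) (j , _) → ¬? (i Fin.≟ j)
  ; ~-sym    = λ i≢j j≡i → i≢j (sym j≡i)
  ; ~-irrefl = λ { refl i≢i → i≢i refl }
  }

infixr 8 _·_
infixr 7 _⊠_

_·_ : ℕ → Graph → Graph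
a · G = record
  { Vertex   = Fin a × Vertex
  ; order    = a * order
  ; finite   = ×-finite (↔-id (Fin a)) finite
  ; _~_      = λ (i , x) (j , y) → i ≡ j × x ~ y
  ; _~?_     = λ (i , x) (j , y) → (i Fin.≟ j) ×-dec (x ~? y)
  ; ~-sym    = λ (i≡j , x~y) → sym i≡j , ~-sym x~y
  ; ~-irrefl = λ { refl (_ , x~x) → ~-irrefl refl x~x }
  }
  where open Graph G

_⊠_ : Graph → Graph → Graph
G ⊠ K = record
  { Vertex   = G.Vertex × K.Vertex
  ; order    = G.order * K.order
  ; finite   = ×-finite G.finite K.finite
  ; _~_      = λ (g , h) (g′ , h′) →
      (g ≡ g′ × h K.~ h′) ⊎ (h ≡ h′ × g G.~ g′) ⊎ (g G.~ g′ × h K.~ h′)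
  ; _~?_     = λ (g , h) (g′ , h′) →
      ((g G.≟ g′) ×-dec (h K.~? h′)) ⊎-dec
      ((h K.≟ h′) ×-dec (g G.~? g′)) ⊎-dec
      ((g G.~? g′) ×-dec (h K.~? h′))
  ; ~-sym    = λ
      { (inj₁ (g≡ , h~))        → inj₁ (sym g≡ , K.~-sym h~)
      ; (inj₂ (inj₁ (h≡ , g~))) → inj₂ (inj₁ (sym h≡ , G.~-sym g~))
      ; (inj₂ (inj₂ (g~ , h~))) → inj₂ (inj₂ (G.~-sym g~ , K.~-sym h~))
      }
  ; ~-irrefl = λ
      { refl (inj₁ (_ , h~))        → K.~-irrefl refl h~
      ; refl (inj₂ (inj₁ (_ , g~))) → G.~-irrefl refl g~
      ; refl (inj₂ (inj₂ (g~ , _))) → G.~-irrefl refl g~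
      }
  }
  where
    module G = Graph G
    module K = Graph K

{-# OPTIONS --safe #-}
module Submission where

-- Write N for the number of vertices. In a distance magic labelling, comparing vertices that
-- differ only in the position within a partite set shows that each of the c = abpq blocks
-- (partite set) × (partite set) is an m × n array with constant row sums and constant column
-- sums. The weights then give a linear system for the block sums which is nonsingular because
-- (m, n) ≠ (2, 2), so all block sums agree and 2R = n(N + 1), 2C = m(N + 1) for the common row
-- and column sums R, C; this is the parity condition. Conversely, c magic rectangles of size
-- m × n with common line sums give a labelling, so it remains to construct these. With labels
-- centred at 0 one needs zero line sums and each value ±x used once.
--
-- If m and n are even, use strips with rows v and -v, where the |v_j| are consecutive odd
-- numbers grouped into quadruples (and one sextuple per strip if n ≡ 2 mod 4) of signed sum 0.
--
-- If everything is odd, a Kotzig array reduces the problem to one rectangle. With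
-- h = (m + n) / 2 - 2, the numbers 1, …, 3h + 1 other than a hole e split into triples
-- a + b = d. A triple fills a 3 × 2 or 2 × 3 block, the larger numbers fill 2 × 4 blocks, and
-- the column e, 0, -e is balanced by column pairs (X, Y, Z), (-Z, -Y, -X), whose row sums
-- X - Z, 0, Z - X for a few small triples cancel e identically in h. A few small sizes are
-- given by tables.

open import Defs
open import Data.Bool using (if_then_else_)
open import Data.Empty using (⊥-elim)
open import Data.Fin using (Fin; zero; suc; toℕ; fromℕ<; splitAt; combine; remQuot; punchOut; _↑ˡ_; _↑ʳ_; _≟_)
open import Data.Fin.Patterns using (0F; 1F; 2F; 3F; 4F; 5F; 6F; 7F; 8F)
open import Data.Fin.Properties using (splitAt-↑ˡ; splitAt-↑ʳ; toℕ<n; toℕ-fromℕ<; toℕ-combine; toℕ-injective; combine-remQuot; punchOut-injective; injective⇒≤; all?; any?)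
open import Data.Integer using (ℤ; +_; -[1+_]; ∣_∣) renaming (_+_ to _+ᶻ_; _*_ to _*ᶻ_; -_ to -ᶻ_; _-_ to _-ᶻ_)
import Data.Integer.Properties as ℤ
open import Data.Integer.Tactic.RingSolver using (solve-∀)
open import Data.List using (map; filter; tabulate)
open import Data.Nat using (ℕ; zero; suc; _+_; _*_; _∸_; _%_; _≤_; _<_; _≥_; _>_; z≤n; s≤s; z<s; s<s; compare; less; equal; greater; ⌊_/2⌋; ⌈_/2⌉)
open import Data.Nat.DivMod using (m*n%n≡0; [m+kn]%n≡m%n)
import Data.Nat.ListAction as List
import Data.Nat.Properties as ℕ
open import Data.Nat.Tactic.RingSolver using () renaming (solve-∀ to solve-∀ᴺ)
open import Data.Product using (∃; ∃₂; _×_; _,_; proj₁; proj₂; map₁)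
open import Data.Sum using (_⊎_; inj₁; inj₂; [_,_])
open import Data.Sum.Properties using ([,]-map)
open import Data.Vec using (Vec; []; _∷_; lookup)
open import Data.Vec.Functional using (_++_)
open import Function using (_∘_)
open import Function.Bundles using (_↔_; _⤖_; _⇔_; Inverse; Bijection; mk⤖; mk⇔)
open import Function.Properties.Bijection using (⤖⇒↔)
open import Function.Properties.Inverse using (↔-sym; ↔-trans)
open import Level using (0ℓ)
open import Relation.Binary.PropositionalEquality using (_≡_; _≢_; refl; sym; trans; cong; cong₂; subst; subst₂; module ≡-Reasoning)
open import Relation.Nullary using (Dec; does; yes; no; ¬_)
open import Relation.Nullary.Decidable using (True; toWitness; ¬?; _×-dec_; _⊎-dec_)
open import Relation.Unary using (Pred; Decidable; _∪_; _⊆_)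

open import Algebra.Properties.Semiring.Sum ℤ.+-*-semiring using (sum; sum-cong-≗; sum-replicate-zero; ∑-distrib-+; ∑-comm; ∑-permute; *-distribˡ-sum)

open Graph hiding (_≟_)

-- Finite sums of integers

sum-zero : ∀ {n} {f : Fin n → ℤ} → (∀ i → f i ≡ + 0) → sum f ≡ + 0
sum-zero {n} f≡0 = trans (sum-cong-≗ f≡0) (sum-replicate-zero n)

sum-neg : ∀ {n} (f : Fin n → ℤ) → sum (λ i → -ᶻ f i) ≡ -ᶻ sum f
sum-neg {zero}  f = refl
sum-neg {suc n} f = trans (cong (-ᶻ f zero +ᶻ_) (sum-neg (f ∘ suc))) (sym (ℤ.neg-distrib-+ (f zero) _))

sum-++ : ∀ {m n} (f : Fin m → ℤ) (g : Fin n → ℤ) → sum (f ++ g) ≡ sum f +ᶻ sum g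
sum-++ {zero}  f g = sym (ℤ.+-identityˡ _)
sum-++ {suc m} f g = begin
  f zero +ᶻ sum ((f ++ g) ∘ suc)        ≡⟨ cong (f zero +ᶻ_) (sum-cong-≗ λ i → [,]-map (splitAt m i)) ⟩
  f zero +ᶻ sum ((f ∘ suc) ++ g)        ≡⟨ cong (f zero +ᶻ_) (sum-++ (f ∘ suc) g) ⟩
  f zero +ᶻ (sum (f ∘ suc) +ᶻ sum g)    ≡⟨ ℤ.+-assoc (f zero) _ _ ⟨
  f zero +ᶻ sum (f ∘ suc) +ᶻ sum g      ∎
  where open ≡-Reasoning

-- Rectangles with prescribed line sums, and their juxtaposition

-- That the entries are distinct is not recorded: once all values of a range of the right size
-- are attained, it follows by counting.
record Rect (m n : ℕ) (ρ : Fin m → ℤ) (P : Pred ℕ 0ℓ) : Set where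
  field
    entry   : Fin m → Fin n → ℤ
    row-sum : ∀ i → sum (entry i) ≡ ρ i
    col-sum : ∀ j → sum (λ i → entry i j) ≡ + 0
    attains : ∀ {x} → P x → (∃₂ λ i j → entry i j ≡ + x) × (∃₂ λ i j → entry i j ≡ -ᶻ + x)

Rect₀ : ℕ → ℕ → Pred ℕ 0ℓ → Set
Rect₀ m n = Rect m n (λ _ → + 0)

open Rect

restrict : ∀ {m n ρ P Q} → Q ⊆ P → Rect m n ρ P → Rect m n ρ Q
restrict Q⊆P A = record
  { entry = entry A ; row-sum = row-sum A ; col-sum = col-sum A ; attains = attains A ∘ Q⊆P }

retarget : ∀ {m n ρ σ P} → (∀ i → ρ i ≡ σ i) → Rect m n ρ P → Rect m n σ P
retarget ρ≗σ A = record
  { entry = entry A ; row-sum = λ i → trans (row-sum A i) (ρ≗σ i)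
  ; col-sum = col-sum A ; attains = attains A }

transpose : ∀ {m n P} → Rect₀ m n P → Rect₀ n m P
transpose A = record
  { entry = λ i j → entry A j i ; row-sum = col-sum A ; col-sum = row-sum A
  ; attains = λ Px → let (i , j , p) , (k , l , q) = attains A Px in (j , i , p) , (l , k , q) }

infixr 5 _∣∣_ _//_

_∣∣_ : ∀ {m n n′ ρ ρ′ P P′} → Rect m n ρ P → Rect m n′ ρ′ P′ →
       Rect m (n + n′) (λ i → ρ i +ᶻ ρ′ i) (P ∪ P′)
_∣∣_ {m} {n} {n′} {ρ} {ρ′} {P} {P′} A B = record
  { entry   = M
  ; row-sum = λ i → trans (sum-++ (entry A i) (entry B i)) (cong₂ _+ᶻ_ (row-sum A i) (row-sum B i))
  ; col-sum = col
  ; attains = λ { (inj₁ Px) → let (i , j , p) , (k , l , q) = attains A Px in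
                    (i , j ↑ˡ n′ , trans (left i j) p) , (k , l ↑ˡ n′ , trans (left k l) q)
                ; (inj₂ Px) → let (i , j , p) , (k , l , q) = attains B Px in
                    (i , n ↑ʳ j , trans (right i j) p) , (k , n ↑ʳ l , trans (right k l) q) }
  }
  where
  M : Fin m → Fin (n + n′) → ℤ
  M i = entry A i ++ entry B i
  left : ∀ i j → M i (j ↑ˡ n′) ≡ entry A i j
  left i j = cong [ entry A i , entry B i ] (splitAt-↑ˡ n j n′)
  right : ∀ i j → M i (n ↑ʳ j) ≡ entry B i j
  right i j = cong [ entry A i , entry B i ] (splitAt-↑ʳ n n′ j)
  col : ∀ j → sum (λ i → M i j) ≡ + 0
  col j with splitAt n j
  ... | inj₁ k = col-sum A k
  ... | inj₂ k = col-sum B k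

_//_ : ∀ {m m′ n P P′} → Rect₀ m n P → Rect₀ m′ n P′ → Rect₀ (m + m′) n (P ∪ P′)
A // B = transpose (transpose A ∣∣ transpose B)

⋃< : ℕ → (ℕ → Pred ℕ 0ℓ) → Pred ℕ 0ℓ
⋃< k P x = ∃ λ r → r < k × P r x

hrepeat : ∀ {m n} {P : ℕ → Pred ℕ 0ℓ} k → (∀ r → Rect₀ m n (P r)) → Rect₀ m (k * n) (⋃< k P)
hrepeat {m} zero A = record
  { entry = λ _ () ; row-sum = λ _ → refl ; col-sum = λ () ; attains = λ { (_ , () , _) } }
hrepeat {P = P} (suc k) A = restrict first-or-later (A 0 ∣∣ hrepeat k (A ∘ suc))
  where
  first-or-later : ⋃< (suc k) P ⊆ P 0 ∪ ⋃< k (P ∘ suc)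
  first-or-later (zero  , _     , Px) = inj₁ Px
  first-or-later (suc r , s<s r<k , Px) = inj₂ (r , r<k , Px)

vrepeat : ∀ {m n} {P : ℕ → Pred ℕ 0ℓ} k → (∀ r → Rect₀ m n (P r)) → Rect₀ (k * m) n (⋃< k P)
vrepeat k A = transpose (hrepeat k (transpose ∘ A))

-- Two-row strips and three-row bands

flip± : ℤ → Fin 2 → ℤ
flip± v 0F = v
flip± v 1F = -ᶻ v

-- Opposite rows make every column cancel and give every absolute value both signs, so only the sum
-- of `v` remains as a condition.
strip : ∀ {n} (v : Fin n → ℤ) → Rect 2 n (flip± (sum v)) (λ x → ∃ λ j → ∣ v j ∣ ≡ x)
strip v = record
  { entry   = λ i j → flip± (v j) i
  ; row-sum = λ { 0F → refl ; 1F → sum-neg v }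
  ; col-sum = λ j → cancel (v j)
  ; attains = λ { (j , refl) → both j (v j) refl }
  }
  where
  cancel : ∀ x → x +ᶻ (-ᶻ x +ᶻ + 0) ≡ + 0
  cancel = solve-∀
  both : ∀ j w → v j ≡ w → (∃₂ λ i j → flip± (v j) i ≡ + ∣ w ∣) × (∃₂ λ i j → flip± (v j) i ≡ -ᶻ + ∣ w ∣)
  both j (+ _)    vj≡w = (0F , j , vj≡w) , (1F , j , cong -ᶻ_ vj≡w)
  both j -[1+ _ ] vj≡w = (1F , j , cong -ᶻ_ vj≡w) , (0F , j , vj≡w)

strip₀ : ∀ {n} (v : Fin n → ℤ) → sum v ≡ + 0 → Rect₀ 2 n (λ x → ∃ λ j → ∣ v j ∣ ≡ x)
strip₀ v ∑v≡0 = retarget (λ { 0F → ∑v≡0 ; 1F → cong -ᶻ_ ∑v≡0 }) (strip v)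

-- The row sums of a three-row band that is not yet balanced. They are determined by one number, and
-- these numbers add under juxtaposition.
skew : ℤ → Fin 3 → ℤ
skew d 0F = d
skew d 1F = + 0
skew d 2F = -ᶻ d

±-attained : ∀ {m n} (M : Fin m → Fin n → ℤ) w {i j k l} → M i j ≡ w → M k l ≡ -ᶻ w →
             (∃₂ λ i j → M i j ≡ + ∣ w ∣) × (∃₂ λ i j → M i j ≡ -ᶻ + ∣ w ∣)
±-attained M (+ _)    p q = (_ , _ , p) , (_ , _ , q)
±-attained M -[1+ _ ] p q = (_ , _ , q) , (_ , _ , p)

column : ∀ a → Rect 3 1 (skew (+ a)) (λ x → x ≡ 0 ⊎ x ≡ a)
column a = record
  { entry   = λ i _ → skew (+ a) i
  ; row-sum = λ i → ℤ.+-identityʳ (skew (+ a) i)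
  ; col-sum = λ _ → cancel (+ a)
  ; attains = λ { (inj₁ refl) → (1F , 0F , refl) , (1F , 0F , refl)
                ; (inj₂ refl) → (0F , 0F , refl) , (2F , 0F , refl) }
  }
  where
  cancel : ∀ x → x +ᶻ (+ 0 +ᶻ (-ᶻ x +ᶻ + 0)) ≡ + 0
  cancel = solve-∀

-- The second column is the first one reversed and negated. Hence X, Z and X + Z occur with both
-- signs, and the middle row cancels.
columnPair : ∀ X Z → Rect 3 2 (skew (X -ᶻ Z)) (λ x → ∣ X ∣ ≡ x ⊎ ∣ Z ∣ ≡ x ⊎ ∣ X +ᶻ Z ∣ ≡ x)
columnPair X Z = record
  { entry   = M
  ; row-sum = λ { 0F → row₀ X Z ; 1F → row₁ (X +ᶻ Z) ; 2F → row₂ X Z }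
  ; col-sum = λ { 0F → col₀ X Z ; 1F → col₁ X Z }
  ; attains = λ { (inj₁ refl)        → ±-attained M X {0F} {0F} {2F} {1F} refl refl
                ; (inj₂ (inj₁ refl)) → ±-attained M Z {2F} {0F} {0F} {1F} refl refl
                ; (inj₂ (inj₂ refl)) → ±-attained M (X +ᶻ Z) {1F} {1F} {1F} {0F} refl refl }
  }
  where
  M : Fin 3 → Fin 2 → ℤ
  M 0F 0F = X
  M 0F 1F = -ᶻ Z
  M 1F 0F = -ᶻ (X +ᶻ Z)
  M 1F 1F = X +ᶻ Z
  M 2F 0F = Z
  M 2F 1F = -ᶻ X
  row₀ : ∀ X Z → X +ᶻ (-ᶻ Z +ᶻ + 0) ≡ X -ᶻ Z
  row₀ = solve-∀
  row₁ : ∀ Y → -ᶻ Y +ᶻ (Y +ᶻ + 0) ≡ + 0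
  row₁ = solve-∀
  row₂ : ∀ X Z → Z +ᶻ (-ᶻ X +ᶻ + 0) ≡ -ᶻ (X -ᶻ Z)
  row₂ = solve-∀
  col₀ : ∀ X Z → X +ᶻ (-ᶻ (X +ᶻ Z) +ᶻ (Z +ᶻ + 0)) ≡ + 0
  col₀ = solve-∀
  col₁ : ∀ X Z → -ᶻ Z +ᶻ ((X +ᶻ Z) +ᶻ (-ᶻ X +ᶻ + 0)) ≡ + 0
  col₁ = solve-∀

Triple : ℕ → ℕ → Pred ℕ 0ℓ
Triple a b x = x ≡ a ⊎ x ≡ b ⊎ x ≡ a + b

-- The three ways in which a triple a, b, a + b enters a pair of columns with nonzero row sums.
pair-b∸a : ∀ a b → Rect 3 2 (skew (+ b -ᶻ + a)) (Triple a b)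
pair-b∸a a b = restrict
  (λ { (inj₁ refl) → inj₂ (inj₁ refl) ; (inj₂ (inj₁ refl)) → inj₁ refl
     ; (inj₂ (inj₂ refl)) → inj₂ (inj₂ (ℕ.+-comm b a)) })
  (columnPair (+ b) (+ a))

pair-a∸b : ∀ a b → Rect 3 2 (skew (+ a -ᶻ + b)) (Triple a b)
pair-a∸b a b = restrict
  (λ { (inj₁ refl) → inj₁ refl ; (inj₂ (inj₁ refl)) → inj₂ (inj₁ refl)
     ; (inj₂ (inj₂ refl)) → inj₂ (inj₂ refl) })
  (columnPair (+ a) (+ b))

pair-∸a∸2b : ∀ a b → Rect 3 2 (skew (-ᶻ (+ a +ᶻ + b) -ᶻ + b)) (Triple a b)
pair-∸a∸2b a b = restrict
  (λ { (inj₁ refl) → inj₂ (inj₂ (trans (cong ∣_∣ (cancel (+ a) (+ b))) (ℤ.∣-i∣≡∣i∣ (+ a))))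
     ; (inj₂ (inj₁ refl)) → inj₂ (inj₁ refl)
     ; (inj₂ (inj₂ refl)) → inj₁ (ℤ.∣-i∣≡∣i∣ (+ (a + b))) })
  (columnPair (-ᶻ (+ a +ᶻ + b)) (+ b))
  where
  cancel : ∀ x y → -ᶻ (x +ᶻ y) +ᶻ y ≡ -ᶻ x
  cancel = solve-∀

skew-zero : ∀ {d} → d ≡ + 0 → ∀ i → skew d i ≡ + 0
skew-zero refl 0F = refl
skew-zero refl 1F = refl
skew-zero refl 2F = refl

skew-+ : ∀ c d i → skew c i +ᶻ skew d i ≡ skew (c +ᶻ d) i
skew-+ c d 0F = refl
skew-+ c d 1F = refl
skew-+ c d 2F = sym (ℤ.neg-distrib-+ c d)

infixr 5 _∣ˢ_

_∣ˢ_ : ∀ {n n′ c d P P′} → Rect 3 n (skew c) P → Rect 3 n′ (skew d) P′ →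
       Rect 3 (n + n′) (skew (c +ᶻ d)) (P ∪ P′)
_∣ˢ_ {c = c} {d} A B = retarget (skew-+ c d) (A ∣∣ B)

triple2×3 : ∀ a b → Rect₀ 2 3 (Triple a b)
triple2×3 a b = restrict
  (λ { (inj₁ refl) → 0F , refl ; (inj₂ (inj₁ refl)) → 1F , refl
     ; (inj₂ (inj₂ refl)) → 2F , ℤ.∣-i∣≡∣i∣ (+ (a + b)) })
  (strip₀ v (cancel (+ a) (+ b)))
  where
  v : Fin 3 → ℤ
  v 0F = + a
  v 1F = + b
  v 2F = -ᶻ (+ a +ᶻ + b)
  cancel : ∀ x y → x +ᶻ (y +ᶻ (-ᶻ (x +ᶻ y) +ᶻ + 0)) ≡ + 0
  cancel = solve-∀

-- Blocks filled by arithmetic progressions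

-- Four terms of an arithmetic progression cancel with the signs +, -, -, +.
quad : ∀ a d → Rect₀ 2 4 (λ x → ∃ λ i → i < 4 × x ≡ a + i * d)
quad a d = restrict covered (strip₀ v (cancel (+ a) (+ (1 * d)) (+ (2 * d)) (+ (3 * d)) (ring (+ d))))
  where
  v : Fin 4 → ℤ
  v 0F = + a
  v 1F = -ᶻ + (a + 1 * d)
  v 2F = -ᶻ + (a + 2 * d)
  v 3F = + (a + 3 * d)
  -- This is d + 2d = 3d in the form into which `1 * d`, `2 * d` and `3 * d` unfold.
  ring : ∀ d → (d +ᶻ + 0) +ᶻ (d +ᶻ (d +ᶻ + 0)) ≡ d +ᶻ (d +ᶻ (d +ᶻ + 0))
  ring = solve-∀
  regroup : ∀ x p q r → x +ᶻ (-ᶻ (x +ᶻ p) +ᶻ (-ᶻ (x +ᶻ q) +ᶻ ((x +ᶻ r) +ᶻ + 0))) ≡ r -ᶻ (p +ᶻ q)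
  regroup = solve-∀
  cancel : ∀ x p q r → p +ᶻ q ≡ r → x +ᶻ (-ᶻ (x +ᶻ p) +ᶻ (-ᶻ (x +ᶻ q) +ᶻ ((x +ᶻ r) +ᶻ + 0))) ≡ + 0
  cancel x p q r refl = trans (regroup x p q r) (ℤ.+-inverseʳ (p +ᶻ q))
  covered : ∀ {x} → (∃ λ i → i < 4 × x ≡ a + i * d) → ∃ λ j → ∣ v j ∣ ≡ x
  covered (0 , _ , refl) = 0F , sym (ℕ.+-identityʳ a)
  covered (1 , _ , refl) = 1F , ℤ.∣-i∣≡∣i∣ (+ (a + 1 * d))
  covered (2 , _ , refl) = 2F , ℤ.∣-i∣≡∣i∣ (+ (a + 2 * d))
  covered (3 , _ , refl) = 3F , refl
  covered (suc (suc (suc (suc _))) , s<s (s<s (s<s (s<s ()))) , _)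

divide : ∀ a b {z} → z < a * b → ∃₂ λ q r → q < a × r < b × z ≡ q * b + r
divide a b {z} z<ab = toℕ q , toℕ r , toℕ<n q , toℕ<n r , (begin
  z                    ≡⟨ toℕ-fromℕ< z<ab ⟨
  toℕ k                ≡⟨ cong toℕ (combine-remQuot {a} b k) ⟨
  toℕ (combine q r)    ≡⟨ toℕ-combine q r ⟩
  b * toℕ q + toℕ r    ≡⟨ cong (_+ toℕ r) (ℕ.*-comm b (toℕ q)) ⟩
  toℕ q * b + toℕ r    ∎)
  where
  open ≡-Reasoning
  k = fromℕ< z<ab
  q = proj₁ (remQuot {a} b k)
  r = proj₂ (remQuot {a} b k)

Progression : ℕ → ℕ → ℕ → Pred ℕ 0ℓ
Progression a d l x = ∃ λ z → z < l × x ≡ a + z * d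

-- The block in row u and column v of the A × B grid takes quadruple number uB + v of the
-- progression.
quads : ∀ a d A B → Rect₀ (A * 2) (B * 4) (Progression a d (A * B * 4))
quads a d A B = restrict covered
  (vrepeat A λ u → hrepeat B λ v → quad (a + (u * B + v) * 4 * d) d)
  where
  regroup : ∀ a d p i → a + (p * 4 + i) * d ≡ a + p * 4 * d + i * d
  regroup = solve-∀ᴺ
  covered : ∀ {x} → Progression a d (A * B * 4) x →
            ∃ λ u → u < A × ∃ λ v → v < B × Progression (a + (u * B + v) * 4 * d) d 4 x
  covered (z , z<l , refl) with divide (A * B) 4 z<l
  ... | p , i , p<AB , i<4 , refl with divide A B p<AB
  ... | u , v , u<A , v<B , refl = u , u<A , v , v<B , i , i<4 , regroup a d (u * B + v) i

-- Small odd rectangles from tables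

-- A table holds the numbers 1, ..., 2H + 1, and subtracting H + 1 centres them at 0. The implicit
-- arguments are settled by evaluating the decision procedures.
fromTable : ∀ {m n} H (T : Vec (Vec ℕ n) m) → let M = λ i j → + lookup (lookup T i) j -ᶻ + suc H in
            {True (all? λ i → sum (M i) ℤ.≟ + 0)} → {True (all? λ j → sum (λ i → M i j) ℤ.≟ + 0)} →
            {True (all? {n = suc H} λ x → (any? λ i → any? λ j → M i j ℤ.≟ + toℕ x)
                                   ×-dec (any? λ i → any? λ j → M i j ℤ.≟ -ᶻ + toℕ x))} →
            Rect₀ m n (_≤ H)
fromTable H T {rows} {cols} {values} = record
  { entry   = λ i j → + lookup (lookup T i) j -ᶻ + suc H
  ; row-sum = toWitness rows
  ; col-sum = toWitness cols
  ; attains = λ x≤H → subst (λ x → (∃₂ λ i j → _ ≡ + x) × (∃₂ λ i j → _ ≡ -ᶻ + x))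
                        (toℕ-fromℕ< (s≤s x≤H)) (toWitness values (fromℕ< (s≤s x≤H)))
  }

rect3×5 : Rect₀ 3 5 (_≤ 7)
rect3×5 = fromTable 7
  ( ( 9 ∷ 14 ∷  2 ∷ 12 ∷  3 ∷ [])
  ∷ ( 5 ∷  4 ∷  7 ∷ 11 ∷ 13 ∷ [])
  ∷ (10 ∷  6 ∷ 15 ∷  1 ∷  8 ∷ [])
  ∷ [])

rect3×7 : Rect₀ 3 7 (_≤ 10)
rect3×7 = fromTable 10
  ( (11 ∷  1 ∷ 12 ∷ 10 ∷ 16 ∷  6 ∷ 21 ∷ [])
  ∷ (20 ∷ 17 ∷  3 ∷  9 ∷ 13 ∷  8 ∷  7 ∷ [])
  ∷ ( 2 ∷ 15 ∷ 18 ∷ 14 ∷  4 ∷ 19 ∷  5 ∷ [])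
  ∷ [])

rect5×5 : Rect₀ 5 5 (_≤ 12)
rect5×5 = fromTable 12
  ( (22 ∷  6 ∷ 16 ∷  2 ∷ 19 ∷ [])
  ∷ ( 5 ∷ 25 ∷  8 ∷ 12 ∷ 15 ∷ [])
  ∷ (24 ∷ 21 ∷  7 ∷ 10 ∷  3 ∷ [])
  ∷ ( 1 ∷  9 ∷ 20 ∷ 18 ∷ 17 ∷ [])
  ∷ (13 ∷  4 ∷ 14 ∷ 23 ∷ 11 ∷ [])
  ∷ [])

rect5×7 : Rect₀ 5 7 (_≤ 17)
rect5×7 = fromTable 17
  ( (24 ∷ 12 ∷ 15 ∷  5 ∷ 16 ∷ 35 ∷ 19 ∷ [])
  ∷ (22 ∷ 28 ∷ 26 ∷ 30 ∷ 11 ∷  8 ∷  1 ∷ [])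
  ∷ (34 ∷ 20 ∷  7 ∷ 13 ∷ 21 ∷  2 ∷ 29 ∷ [])
  ∷ ( 4 ∷  3 ∷ 32 ∷ 33 ∷ 17 ∷ 14 ∷ 23 ∷ [])
  ∷ ( 6 ∷ 27 ∷ 10 ∷  9 ∷ 25 ∷ 31 ∷ 18 ∷ [])
  ∷ [])

rect7×7 : Rect₀ 7 7 (_≤ 24)
rect7×7 = fromTable 24
  ( (31 ∷ 13 ∷ 48 ∷ 49 ∷ 15 ∷  3 ∷ 16 ∷ [])
  ∷ ( 5 ∷ 37 ∷ 28 ∷ 34 ∷ 18 ∷ 21 ∷ 32 ∷ [])
  ∷ (12 ∷ 27 ∷  4 ∷ 42 ∷ 41 ∷ 29 ∷ 20 ∷ [])
  ∷ ( 1 ∷ 33 ∷ 47 ∷ 10 ∷ 43 ∷  2 ∷ 39 ∷ [])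
  ∷ (36 ∷ 17 ∷ 14 ∷ 11 ∷ 19 ∷ 40 ∷ 38 ∷ [])
  ∷ (44 ∷ 23 ∷  8 ∷ 22 ∷  9 ∷ 45 ∷ 24 ∷ [])
  ∷ (46 ∷ 25 ∷ 26 ∷  7 ∷ 30 ∷ 35 ∷  6 ∷ [])
  ∷ [])

rect5×9 : Rect₀ 5 9 (_≤ 22)
rect5×9 = fromTable 22
  ( (44 ∷ 41 ∷  5 ∷  8 ∷ 35 ∷ 30 ∷ 20 ∷ 15 ∷  9 ∷ [])
  ∷ (42 ∷ 17 ∷ 40 ∷ 16 ∷  4 ∷ 33 ∷ 31 ∷ 13 ∷ 11 ∷ [])
  ∷ (10 ∷  6 ∷ 29 ∷ 25 ∷  2 ∷ 23 ∷ 45 ∷ 39 ∷ 28 ∷ [])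
  ∷ ( 7 ∷ 14 ∷ 19 ∷ 32 ∷ 38 ∷ 26 ∷  1 ∷ 27 ∷ 43 ∷ [])
  ∷ (12 ∷ 37 ∷ 22 ∷ 34 ∷ 36 ∷  3 ∷ 18 ∷ 21 ∷ 24 ∷ [])
  ∷ [])

-- Partition into triples

-- The lower end of the pair with difference y: it is e - j for y = 2j and f - j for y = 2j + 1, so
-- the upper ends are e + j and f + 1 + j.
base : ℕ → ℕ → ℕ → ℕ
base e f 0             = e
base e f 1             = f
base e f (suc (suc y)) = base e f y ∸ 1

base-even : ∀ e f j → base e f (j * 2) ≡ e ∸ j
base-even e f zero    = refl
base-even e f (suc j) = trans (cong (_∸ 1) (base-even e f j)) (trans (ℕ.∸-+-assoc e j 1) (cong (e ∸_) (ℕ.+-comm j 1)))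

base-odd : ∀ e f j → base e f (suc (j * 2)) ≡ f ∸ j
base-odd e f zero    = refl
base-odd e f (suc j) = trans (cong (_∸ 1) (base-odd e f j)) (trans (ℕ.∸-+-assoc f j 1) (cong (f ∸_) (ℕ.+-comm j 1)))

j*2≡j+j : ∀ j → j * 2 ≡ j + j
j*2≡j+j = solve-∀ᴺ

-- The even y are the differences of the pairs nested around e, the odd y those of the pairs
-- nested around f + 1/2; the two nests fill the interval from h + 1 to 3h + 1 except for e.
triples-cover : ∀ k l {e f x} → k ≤ l → l ≤ suc k → e ≡ suc (k + l) + k → f ≡ suc (k + l) + (k + k) + l →
                x ≤ suc (3 * (k + l)) →
                x ≡ 0 ⊎ x ≡ e ⊎ ⋃< (k + l) (λ y → Triple (suc y) (base e f (suc y))) x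
triples-cover k l {x = zero} _ _ _ _ _ = inj₁ refl
triples-cover k l {e} {f} {suc i} k≤l l≤1+k refl refl x≤ with i ℕ.<? k + l
... | yes i<h = inj₂ (inj₂ (i , i<h , inj₁ refl))
... | no  i≮h with ℕ.m≤n⇒∃[o]m+o≡n (ℕ.≮⇒≥ i≮h)
... | o , refl = inj₂ (nests o x≤)
  where
  h = k + l
  Covered : Pred ℕ 0ℓ
  Covered = ⋃< h (λ y → Triple (suc y) (base e f (suc y)))
  even-below : ∀ j {g} → suc j ≤ k → e ≡ g + suc j → Covered g × Covered (e + suc j)
  even-below j {g} j<k eq =
    (suc (j * 2) , y<h , inj₂ (inj₁ (sym b≡g))) ,
    (suc (j * 2) , y<h , inj₂ (inj₂ (trans (trans (cong (_+ suc j) eq) (regroup g j)) (cong (λ z → suc (suc (j * 2)) + z) (sym b≡g)))))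
    where
    b≡g : base e f (suc j * 2) ≡ g
    b≡g = trans (base-even e f (suc j)) (trans (cong (_∸ suc j) eq) (ℕ.m+n∸n≡m g (suc j)))
    -- The bounds `k ≤ l` and, in `odd-below`, `l ≤ suc k` keep the even differences up to 2k and
    -- the odd ones up to 2l - 1 within h = k + l.
    y<h : suc (j * 2) < h
    y<h = subst (_≤ h) (sym (j*2≡j+j (suc j))) (ℕ.+-mono-≤ j<k (ℕ.≤-trans j<k k≤l))
    regroup : ∀ g j → g + suc j + suc j ≡ suc (suc (j * 2)) + g
    regroup = solve-∀ᴺ
  odd-below : ∀ j {g} → j < l → f ≡ g + j → Covered g × Covered (suc (f + j))
  odd-below j {g} j<l eq =
    (j * 2 , y<h , inj₂ (inj₁ (sym b≡g))) ,
    (j * 2 , y<h , inj₂ (inj₂ (trans (cong (λ z → suc (z + j)) eq) (trans (regroup g j) (cong (λ z → suc (j * 2) + z) (sym b≡g))))))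
    where
    b≡g : base e f (suc (j * 2)) ≡ g
    b≡g = trans (base-odd e f j) (trans (cong (_∸ j) eq) (ℕ.m+n∸n≡m g j))
    y<h : j * 2 < h
    y<h = subst (_< h) (sym (j*2≡j+j j)) (ℕ.+-mono-≤-< (ℕ.≤-pred (ℕ.≤-trans j<l l≤1+k)) j<l)
    regroup : ∀ g j → suc (g + j + j) ≡ suc (j * 2) + g
    regroup = solve-∀ᴺ
  nests : ∀ o → suc (h + o) ≤ suc (3 * h) → suc (h + o) ≡ e ⊎ Covered (suc (h + o))
  -- As o grows, h + 1 + o runs through the lower ends of the even nest, then e, the upper ends of
  -- that nest, and the lower and the upper ends of the odd nest.
  nests o x≤ with compare o k
  ... | less .o j = inj₂ (proj₁ (even-below j (s≤s (ℕ.m≤n+m j o)) (regroup h o j)))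
    where
    regroup : ∀ h o j → suc h + suc (o + j) ≡ suc (h + o) + suc j
    regroup = solve-∀ᴺ
  ... | equal .o = inj₁ refl
  ... | greater .k j with j ℕ.<? k
  ... | yes j<k = inj₂ (subst Covered (regroup h k j)
                    (proj₂ (even-below j {suc h + (k ∸ suc j)} j<k
                      (trans (cong (λ z → suc h + z) (sym (ℕ.m∸n+n≡m j<k))) (sym (ℕ.+-assoc (suc h) _ (suc j)))))))
    where
    regroup : ∀ h k j → suc h + k + suc j ≡ suc (h + suc (k + j))
    regroup = solve-∀ᴺ
  ... | no j≮k with ℕ.m≤n⇒∃[o]m+o≡n (ℕ.≮⇒≥ j≮k)
  ... | i , refl with i ℕ.<? l
  ... | yes i<l = inj₂ (proj₁ (odd-below (l ∸ suc i) (ℕ.∸-monoʳ-< z<s i<l)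
                    (trans (cong (λ z → suc h + (k + k) + z) (sym (ℕ.m+[n∸m]≡n i<l))) (regroup h k i (l ∸ suc i)))))
    where
    regroup : ∀ h k i j → suc h + (k + k) + (suc i + j) ≡ suc (h + suc (k + (k + i))) + j
    regroup = solve-∀ᴺ
  ... | no i≮l with ℕ.m≤n⇒∃[o]m+o≡n (ℕ.≮⇒≥ i≮l)
  ... | j′ , refl = inj₂ (subst Covered (cong suc (regroup h k l j′))
                      (proj₂ (odd-below j′ {suc h + (k + k) + (l ∸ j′)} j′<l
                        (trans (cong (λ z → suc h + (k + k) + z) (sym (ℕ.m∸n+n≡m (ℕ.<⇒≤ j′<l)))) (sym (ℕ.+-assoc (suc h + (k + k)) _ j′))))))
    where
    regroup : ∀ h k l j → suc h + (k + k) + l + j ≡ h + suc (k + (k + (l + j)))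
    regroup = solve-∀ᴺ
    left : ∀ h k l j → suc (h + suc (k + (k + (l + j)))) ≡ suc (h + (k + k) + l) + suc j
    left = solve-∀ᴺ
    right : ∀ k l → suc (3 * (k + l)) ≡ suc (k + l + (k + k) + l) + l
    right = solve-∀ᴺ
    j′<l : j′ < l
    j′<l = ℕ.+-cancelˡ-≤ (suc (h + (k + k) + l)) _ _ (subst₂ _≤_ (left h k l j′) (right k l) x≤)


-- Magic rectangles of odd order

⌈n/2⌉≤1+⌊n/2⌋ : ∀ n → ⌈ n /2⌉ ≤ suc ⌊ n /2⌋
⌈n/2⌉≤1+⌊n/2⌋ n = ℕ.⌊n/2⌋-mono (ℕ.n≤1+n (suc n))

split-at : ∀ a {x b} → x < a + b → x < a ⊎ ∃ λ z → z < b × x ≡ a + z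
split-at a {x} {b} x<a+b with x ℕ.<? a
... | yes x<a = inj₁ x<a
... | no  x≮a with ℕ.m≤n⇒∃[o]m+o≡n (ℕ.≮⇒≥ x≮a)
... | z , refl = inj₂ (z , ℕ.+-cancelˡ-< a z b x<a+b , refl)

progression-1 : ∀ {a z l} → z < l → Progression a 1 l (a + z)
progression-1 {a} {z} z<l = z , z<l , cong (λ w → a + w) (sym (ℕ.*-identityʳ z))

-- (3 + 2M)(3 + 2Q) = 1 + 2 half M Q
half : ℕ → ℕ → ℕ
half M Q = 4 + 3 * (M + Q) + 2 * (M * Q)

Tri : ℕ → ℕ → ℕ → Pred ℕ 0ℓ
Tri e f y = Triple (suc y) (base e f (suc y))

-- The hole e′ and the triples of 2, 4, 1, 3 contribute the defects e′, e′ - 3, -2e′, f′ - 1, 4 -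
-- f′, whose sum is identically 0. Taking e′ = 2 + e and f′ = 1 + f lets the truncated subtractions
-- in `base` compute.
core3×9 : ∀ e f → let e′ = 2 + e; f′ = 1 + f in
          Rect₀ 3 9 (λ x → x ≡ 0 ⊎ x ≡ e′ ⊎ ⋃< 4 (Tri e′ f′) x)
core3×9 e f = restrict covered (retarget (skew-zero (balance (+ e) (+ f)))
  (column (2 + e) ∣ˢ pair-b∸a 2 (1 + e) ∣ˢ pair-∸a∸2b 4 e ∣ˢ pair-b∸a 1 (1 + f) ∣ˢ pair-a∸b 3 f))
  where
  balance : ∀ e f → (+ 2 +ᶻ e) +ᶻ (((+ 1 +ᶻ e) -ᶻ + 2) +ᶻ ((-ᶻ (+ 4 +ᶻ e) -ᶻ e)
              +ᶻ (((+ 1 +ᶻ f) -ᶻ + 1) +ᶻ (+ 3 -ᶻ f)))) ≡ + 0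
  balance = solve-∀
  covered : ∀ {x} → x ≡ 0 ⊎ x ≡ 2 + e ⊎ ⋃< 4 (Tri (2 + e) (1 + f)) x → _
  covered (inj₁ p)                    = inj₁ (inj₁ p)
  covered (inj₂ (inj₁ p))             = inj₁ (inj₂ p)
  covered (inj₂ (inj₂ (0 , _ , t)))   = inj₂ (inj₂ (inj₂ (inj₁ t)))
  covered (inj₂ (inj₂ (1 , _ , t)))   = inj₂ (inj₁ t)
  covered (inj₂ (inj₂ (2 , _ , t)))   = inj₂ (inj₂ (inj₂ (inj₂ t)))
  covered (inj₂ (inj₂ (3 , _ , t)))   = inj₂ (inj₂ (inj₁ t))
  covered (inj₂ (inj₂ (suc (suc (suc (suc _))) , s<s (s<s (s<s (s<s ()))) , _)))

-- Blocks of size 4 × 2 tile the rectangle if M is even, blocks of size 2 × 4 if Q is even.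
evenBlock : ∀ a M Q → (∃ λ M₂ → M ≡ M₂ * 2) ⊎ (∃ λ Q₂ → Q ≡ Q₂ * 2) →
            Rect₀ (M * 2) (Q * 2) (Progression a 1 (M * Q * 2))
evenBlock a M Q (inj₁ (M₂ , refl)) =
  subst₂ (λ r l → Rect₀ r (Q * 2) (Progression a 1 l)) (rows M₂) (size Q M₂) (transpose (quads a 1 Q M₂))
  where
  rows : ∀ M → M * 4 ≡ M * 2 * 2
  rows = solve-∀ᴺ
  size : ∀ Q M → Q * M * 4 ≡ M * 2 * Q * 2
  size = solve-∀ᴺ
evenBlock a M Q (inj₂ (Q₂ , refl)) =
  subst₂ (λ c l → Rect₀ (M * 2) c (Progression a 1 l)) (cols Q₂) (size M Q₂) (quads a 1 M Q₂)
  where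
  cols : ∀ Q → Q * 4 ≡ Q * 2 * 2
  cols = solve-∀ᴺ
  size : ∀ M Q → M * Q * 4 ≡ M * (Q * 2) * 2
  size = solve-∀ᴺ

-- The top band consists of `core3×9` and Q upright triples. Below it, M lying triples fill three
-- columns, and the numbers from 3h + 2 on fill the remaining even block.
rect-even : ∀ M Q → (∃ λ M₂ → M ≡ M₂ * 2) ⊎ (∃ λ Q₂ → 3 + Q ≡ Q₂ * 2) →
            Rect₀ (3 + M * 2) (3 + (3 + Q) * 2) (_≤ half M (3 + Q))
rect-even M Q even = restrict covered
  ((core3×9 e₀ f₀ ∣∣ hrepeat Q λ r → transpose (triple2×3 (5 + r) (base e f (5 + r))))
   // (vrepeat M (λ r → triple2×3 (5 + (Q + r)) (base e f (5 + (Q + r))))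
       ∣∣ evenBlock (2 + 3 * h) M (3 + Q) even))
  where
  h = 4 + (Q + M)
  k = ⌊ h /2⌋
  l = ⌈ h /2⌉
  -- `triples-cover` asks for e = h + 1 + k and f = h + 1 + 2k + l; these are e₀ + 2 and f₀ + 1,
  -- since k = 2 + ⌊(Q + M) / 2⌋.
  e₀ = suc h + ⌊ Q + M /2⌋
  f₀ = h + (k + k) + l
  e = 2 + e₀
  f = 1 + f₀
  k+l≡h : k + l ≡ h
  k+l≡h = ℕ.⌊n/2⌋+⌈n/2⌉≡n h
  e≡ : e ≡ suc (k + l) + k
  e≡ = trans (regroup (suc h) ⌊ Q + M /2⌋) (cong (λ z → suc z + k) (sym k+l≡h))
    where
    regroup : ∀ a b → 2 + (a + b) ≡ a + (2 + b)
    regroup = solve-∀ᴺ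
  f≡ : f ≡ suc (k + l) + (k + k) + l
  f≡ = cong (λ z → suc z + (k + k) + l) (sym k+l≡h)
  size : ∀ M Q → suc (4 + 3 * (M + (3 + Q)) + 2 * (M * (3 + Q))) ≡ 2 + 3 * (4 + (Q + M)) + M * (3 + Q) * 2
  size = solve-∀ᴺ
  covered : ∀ {x} → x ≤ half M (3 + Q) → _
  covered {x} x≤ with split-at (2 + 3 * h) (subst (x <_) (size M Q) (s≤s x≤))
  ... | inj₂ (z , z<l , refl) = inj₂ (inj₂ (progression-1 z<l))
  ... | inj₁ (s≤s x≤1+3h) with triples-cover k l (ℕ.⌊n/2⌋≤⌈n/2⌉ h) (⌈n/2⌉≤1+⌊n/2⌋ h) e≡ f≡
                                 (subst (λ z → x ≤ suc (3 * z)) (sym k+l≡h) x≤1+3h)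
  ... | inj₁ p = inj₁ (inj₁ (inj₁ p))
  ... | inj₂ (inj₁ p) = inj₁ (inj₁ (inj₂ (inj₁ p)))
  ... | inj₂ (inj₂ (y , y<k+l , t)) with split-at 4 {b = Q + M} (subst (y <_) k+l≡h y<k+l)
  ... | inj₁ y<4 = inj₁ (inj₁ (inj₂ (inj₂ (y , y<4 , t))))
  ... | inj₂ (r , r<Q+M , refl) with split-at Q r<Q+M
  ... | inj₁ r<Q = inj₁ (inj₂ (r , r<Q , t))
  ... | inj₂ (r′ , r′<M , refl) = inj₂ (inj₁ (r′ , r′<M , t))

-- With E = 3 + e, a hole at E and the triples of 2 and 4 would leave the defect E + (E - 3) - 2E =
-- -3; a hole at E + 3 removes it.
core3×5 : ∀ e f → Rect₀ 3 5 (λ x → (x ≡ 0 ⊎ x ≡ 6 + e) ⊎ Tri (3 + e) f 1 x ⊎ Tri (3 + e) f 3 x)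
core3×5 e f = retarget (skew-zero (balance (+ e)))
  (column (6 + e) ∣ˢ pair-b∸a 2 (2 + e) ∣ˢ pair-∸a∸2b 4 (1 + e))
  where
  balance : ∀ e → (+ 6 +ᶻ e) +ᶻ (((+ 2 +ᶻ e) -ᶻ + 2) +ᶻ (-ᶻ (+ 4 +ᶻ (+ 1 +ᶻ e)) -ᶻ (+ 1 +ᶻ e))) ≡ + 0
  balance = solve-∀

-- The surplus 6 + e - (3 + e) = 3 is cancelled by x - (x + 3), and the other four numbers cancel as
-- (x + 1) - (x + 2) - (x + 4) + (x + 5).
strip2×9 : ∀ e x → Rect₀ 2 9 ((λ y → y ≡ 6 ⊎ y ≡ e ⊎ y ≡ 3 + e) ∪ Progression x 1 6)
strip2×9 e x = restrict covered (strip₀ v (balance (+ e) (+ x)))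
  where
  v : Fin 9 → ℤ
  v 0F = + 6
  v 1F = + e
  v 2F = -ᶻ (+ 3 +ᶻ + e)
  v 3F = + x
  v 4F = -ᶻ (+ x +ᶻ + 3)
  v 5F = + x +ᶻ + 1
  v 6F = -ᶻ (+ x +ᶻ + 2)
  v 7F = -ᶻ (+ x +ᶻ + 4)
  v 8F = + x +ᶻ + 5
  balance : ∀ e x → + 6 +ᶻ (e +ᶻ (-ᶻ (+ 3 +ᶻ e) +ᶻ (x +ᶻ (-ᶻ (x +ᶻ + 3) +ᶻ ((x +ᶻ + 1) +ᶻ
              (-ᶻ (x +ᶻ + 2) +ᶻ (-ᶻ (x +ᶻ + 4) +ᶻ ((x +ᶻ + 5) +ᶻ + 0)))))))) ≡ + 0
  balance = solve-∀
  covered : ∀ {y} → (y ≡ 6 ⊎ y ≡ e ⊎ y ≡ 3 + e) ⊎ Progression x 1 6 y → ∃ λ j → ∣ v j ∣ ≡ y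
  covered (inj₁ (inj₁ refl))        = 0F , refl
  covered (inj₁ (inj₂ (inj₁ refl))) = 1F , refl
  covered (inj₁ (inj₂ (inj₂ refl))) = 2F , refl
  covered (inj₂ (0 , _ , refl)) = 3F , sym (ℕ.+-identityʳ x)
  covered (inj₂ (1 , _ , refl)) = 5F , refl
  covered (inj₂ (2 , _ , refl)) = 6F , ℤ.∣-i∣≡∣i∣ (+ (x + 2))
  covered (inj₂ (3 , _ , refl)) = 4F , ℤ.∣-i∣≡∣i∣ (+ (x + 3))
  covered (inj₂ (4 , _ , refl)) = 7F , ℤ.∣-i∣≡∣i∣ (+ (x + 4))
  covered (inj₂ (5 , _ , refl)) = 8F , refl
  covered (inj₂ (suc (suc (suc (suc (suc (suc _))))) , s<s (s<s (s<s (s<s (s<s (s<s ()))))) , _))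

-- Tri e f y is the triple of y + 1; this lists the triples other than those of 2, 4 and 6.
spare : ℕ → ℕ
spare 0                   = 0
spare 1                   = 2
spare 2                   = 4
spare (suc (suc (suc r))) = 6 + r

-- Here the number of entries left for quadruples is 2 modulo 4. The hole moves from e to e + 3,
-- which turns the triple of 6 into 6, e - 3, e; its defect 3 is compensated by x, x + 3.
rect-odd : ∀ M Q w → M + Q ≡ suc w →
           Rect₀ (3 + (1 + M * 2) * 2) (3 + (3 + Q * 2) * 2) (_≤ half (1 + M * 2) (3 + Q * 2))
rect-odd M Q w M+Q≡1+w = restrict covered
  -- The bands have 3, 2 and 4M rows. The spare triples fill the top band first and then the three
  -- left columns of the bottom band.
  ((core3×5 e₀ f ∣∣ hrepeat (2 + Q * 2) λ r → transpose (tri (spare r)))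
   // (strip2×9 e₀ X ∣∣ subst (λ c → Rect₀ 2 c (Progression (X + 6) 1 (1 * Q * 4))) (4≡2*2 Q) (quads (X + 6) 1 1 Q))
   // (vrepeat (M * 2) (λ r → tri (spare (2 + Q * 2 + r)))
       ∣∣ subst (λ r → Rect₀ r ((3 + Q * 2) * 2) (Progression (X + 6 + Q * 4) 1 ((3 + Q * 2) * M * 4))) (4≡2*2 M)
            (transpose (quads (X + 6 + Q * 4) 1 (3 + Q * 2) M))))
  where
  -- Here h = 7 + 2w is odd, so l = k + 1, and h ≥ 7 provides a triple of 6. For M = Q = 0, where h
  -- would be 5, there is a table.
  k = 3 + w
  l = 4 + w
  h = k + l
  e₀ = 8 + 3 * w
  e = 3 + e₀
  f = suc h + (k + k) + l
  X = 2 + 3 * h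
  tri : ∀ y → Rect₀ 2 3 (Tri e f y)
  tri y = triple2×3 (suc y) (base e f (suc y))
  4≡2*2 : ∀ a → a * 4 ≡ a * 2 * 2
  4≡2*2 = solve-∀ᴺ
  e≡ : ∀ w → 11 + 3 * w ≡ suc ((3 + w) + (4 + w)) + (3 + w)
  e≡ = solve-∀ᴺ
  h≡ : h ≡ 3 + (2 + Q * 2 + M * 2)
  h≡ = trans (left w) (trans (cong (λ z → 5 + z * 2) (sym M+Q≡1+w)) (right M Q))
    where
    left : ∀ w → (3 + w) + (4 + w) ≡ 5 + suc w * 2
    left = solve-∀ᴺ
    right : ∀ M Q → 5 + (M + Q) * 2 ≡ 3 + (2 + Q * 2 + M * 2)
    right = solve-∀ᴺ
  size : suc (half (1 + M * 2) (3 + Q * 2)) ≡ X + (6 + (1 * Q * 4 + (3 + Q * 2) * M * 4))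
  size = trans (size′ M Q) (cong (λ z → 2 + 3 * z + (6 + (1 * Q * 4 + (3 + Q * 2) * M * 4))) (sym h≡))
    where
    size′ : ∀ M Q → suc (4 + 3 * ((1 + M * 2) + (3 + Q * 2)) + 2 * ((1 + M * 2) * (3 + Q * 2))) ≡
                    2 + 3 * (3 + (2 + Q * 2 + M * 2)) + (6 + (1 * Q * 4 + (3 + Q * 2) * M * 4))
    size′ = solve-∀ᴺ
  Spare : ℕ → Set
  Spare x = ⋃< (2 + Q * 2) (Tri e f ∘ spare) x ⊎ ⋃< (M * 2) (λ r → Tri e f (spare (2 + Q * 2 + r))) x
  spared : ∀ s {x} → s < 2 + Q * 2 + M * 2 → Tri e f (spare s) x → Spare x
  spared s s< t with split-at (2 + Q * 2) s<
  ... | inj₁ s<′           = inj₁ (s , s<′ , t)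
  ... | inj₂ (r , r< , refl) = inj₂ (r , r< , t)
  late : ∀ {s} → 3 + s < h → s < 2 + Q * 2 + M * 2
  late {s} lt = ℕ.+-cancelˡ-< 3 s _ (subst (3 + s <_) h≡ lt)
  Inner : ℕ → Set
  Inner x = ((x ≡ 0 ⊎ x ≡ 6 + e₀) ⊎ Tri e f 1 x ⊎ Tri e f 3 x) ⊎ (x ≡ 6 ⊎ x ≡ e₀ ⊎ x ≡ 3 + e₀) ⊎ Spare x
  inner : ∀ y {x} → y < h → Tri e f y x → Inner x
  inner 0 _ t = inj₂ (inj₂ (spared 0 z<s t))
  inner 1 _ t = inj₁ (inj₂ (inj₁ t))
  inner 2 _ t = inj₂ (inj₂ (spared 1 (s<s z<s) t))
  inner 3 _ t = inj₁ (inj₂ (inj₂ t))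
  inner 4 _ t = inj₂ (inj₂ (spared 2 (late {2} (s<s (s<s (s<s (subst (λ z → 2 < z) (sym (ℕ.+-comm w (4 + w))) (s<s (s<s z<s))))))) t))
  -- The triple of 6 is broken up: 6 and e - 3 join the old hole e in the strip, and e + 3 becomes
  -- the new hole.
  inner 5 _ (inj₁ p)        = inj₂ (inj₁ (inj₁ p))
  inner 5 _ (inj₂ (inj₁ p)) = inj₂ (inj₁ (inj₂ (inj₁ p)))
  inner 5 _ (inj₂ (inj₂ p)) = inj₁ (inj₁ (inj₂ p))
  inner (suc (suc (suc (suc (suc (suc r)))))) lt t = inj₂ (inj₂ (spared (3 + r) (late lt) t))
  place : ∀ {x} → Inner x → _
  place (inj₁ p)                  = inj₁ (inj₁ p)
  place (inj₂ (inj₁ p))           = inj₂ (inj₁ (inj₁ (inj₁ p)))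
  place (inj₂ (inj₂ (inj₁ p)))    = inj₁ (inj₂ p)
  place (inj₂ (inj₂ (inj₂ p)))    = inj₂ (inj₂ (inj₁ p))
  outer : ∀ {z} → z < 6 + (1 * Q * 4 + (3 + Q * 2) * M * 4) → _
  outer {z} z< with split-at 6 z<
  ... | inj₁ z<6 = inj₂ (inj₁ (inj₁ (inj₂ (progression-1 {X} z<6))))
  ... | inj₂ (z′ , z′< , refl) with split-at (1 * Q * 4) z′<
  ... | inj₁ z′<Q = inj₂ (inj₁ (inj₂ (subst (Progression (X + 6) 1 _) (ℕ.+-assoc X 6 z′) (progression-1 z′<Q))))
  ... | inj₂ (z″ , z″< , refl) = inj₂ (inj₂ (inj₂ (subst (Progression (X + 6 + Q * 4) 1 _) (regroup X Q z″) (progression-1 z″<))))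
    where
    regroup : ∀ X Q z → X + 6 + Q * 4 + z ≡ X + (6 + (1 * Q * 4 + z))
    regroup = solve-∀ᴺ
  covered : ∀ {x} → x ≤ half (1 + M * 2) (3 + Q * 2) → _
  covered {x} x≤ with split-at X (subst (x <_) size (s≤s x≤))
  ... | inj₂ (z , z< , refl) = outer z<
  ... | inj₁ (s≤s x≤1+3h) with triples-cover k l (ℕ.n≤1+n k) ℕ.≤-refl (e≡ w) refl x≤1+3h
  ... | inj₁ p = place (inj₁ (inj₁ (inj₁ p)))
  ... | inj₂ (inj₁ p) = place (inj₂ (inj₁ (inj₂ (inj₂ p))))
  ... | inj₂ (inj₂ (y , y<h , t)) = place (inner y y<h t)

halve : ∀ n → ∃ λ j → n ≡ j * 2 ⊎ n ≡ 1 + j * 2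
halve zero    = 0 , inj₁ refl
halve (suc n) with halve n
... | j , inj₁ refl = j , inj₂ refl
... | j , inj₂ refl = suc j , inj₁ refl

-- There are at most as many rows as columns, so fewer than nine columns leave five sizes, all
-- tabulated. From nine columns on, the even block can be tiled by quadruples unless both of its
-- sides are 2 modulo 4; that case goes to `rect-odd` or to the 5 × 9 table.
rect-wide : ∀ M Q → M ≤ suc Q → Rect₀ (3 + M * 2) (3 + (1 + Q) * 2) (_≤ half M (1 + Q))
rect-wide 0 0 _ = rect3×5
rect-wide 1 0 _ = rect5×5
rect-wide (suc (suc _)) 0 (s≤s ())
rect-wide 0 1 _ = rect3×7
rect-wide 1 1 _ = rect5×7
rect-wide 2 1 _ = rect7×7
rect-wide (suc (suc (suc _))) 1 (s≤s (s≤s ()))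
rect-wide M (suc (suc Q)) _ with halve M | halve Q
... | M₂ , inj₁ M≡  | _            = rect-even M Q (inj₁ (M₂ , M≡))
... | _  , inj₂ _   | Q₂ , inj₂ refl = rect-even M (1 + Q₂ * 2) (inj₂ (2 + Q₂ , refl))
... | zero   , inj₂ refl | zero   , inj₁ refl = rect5×9
... | suc M₂ , inj₂ refl | Q₂     , inj₁ refl = rect-odd (suc M₂) Q₂ (M₂ + Q₂) refl
... | zero   , inj₂ refl | suc Q₂ , inj₁ refl = rect-odd 0 (suc Q₂) Q₂ refl

oddRect : ∀ M Q → 1 ≤ Q → Rect₀ (3 + M * 2) (3 + Q * 2) (_≤ half M Q)
oddRect M (suc Q) _ with ℕ.≤-total M (suc Q)
... | inj₁ M≤Q = rect-wide M Q M≤Q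
oddRect (suc M) (suc Q) _ | inj₂ Q≤M =
  subst (λ H → Rect₀ (3 + suc M * 2) (3 + suc Q * 2) (_≤ H)) (half-comm (suc Q) (suc M)) (transpose (rect-wide (suc Q) M Q≤M))
  where
  half-comm : ∀ M Q → 4 + 3 * (M + Q) + 2 * (M * Q) ≡ 4 + 3 * (Q + M) + 2 * (Q * M)
  half-comm = solve-∀ᴺ

-- Sets of magic rectangles

-- With N = c(mn), the label v + 1 is encoded as 2(v + 1) - (N + 1). Doubling avoids halves when N
-- is even, and the common line sums become 0. Distinctness again follows by counting.
record MagicSet (c m n : ℕ) : Set where
  field
    entry   : Fin c → Fin m → Fin n → ℤ
    row-sum : ∀ γ i → sum (entry γ i) ≡ + 0
    col-sum : ∀ γ j → sum (λ i → entry γ i j) ≡ + 0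
    attains : ∀ {v} → v < c * (m * n) →
              ∃ λ γ → ∃₂ λ i j → entry γ i j ≡ + (1 + v * 2) -ᶻ + (c * (m * n))

-- For N = 2W, the encoded value of v = W + z is 1 + 2z, and that of v = W - 1 - z is -(1 + 2z).
lower-upper : ∀ W {v} → v < W * 2 → (∃ λ z → z < W × v ≡ W + z) ⊎ (∃ λ z → z < W × W ≡ suc (v + z))
lower-upper W {v} v< with v ℕ.<? W
... | yes v<W = let z , eq = ℕ.m≤n⇒∃[o]m+o≡n v<W in
                inj₂ (z , subst (z <_) eq (s≤s (ℕ.m≤n+m z v)) , sym eq)
... | no  v≮W = let z , eq = ℕ.m≤n⇒∃[o]m+o≡n (ℕ.≮⇒≥ v≮W) in
                inj₁ (z , ℕ.+-cancelˡ-< W z W (subst₂ _<_ (sym eq) (j*2≡j+j W) v<) , sym eq)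

-- For even N the encoded values are the odd numbers ±(1 + 2z) with z < W, so it suffices that the
-- rectangles together attain these.
fromRects : ∀ {c m n} {P : ℕ → Pred ℕ 0ℓ} W → c * (m * n) ≡ W * 2 → (∀ γ → Rect₀ m n (P γ)) →
            (∀ {z} → z < W → ∃ λ γ → γ < c × P γ (1 + z * 2)) → MagicSet c m n
fromRects {c} {m} {n} {P} W N≡ A cover = record
  { entry   = λ γ → entry (A (toℕ γ))
  ; row-sum = λ γ → row-sum (A (toℕ γ))
  ; col-sum = λ γ → col-sum (A (toℕ γ))
  ; attains = λ {v} v< → value (lower-upper W (subst (v <_) N≡ v<))
  }
  where
  above : ∀ z W → + 1 +ᶻ z ≡ + 1 +ᶻ (W +ᶻ z) -ᶻ W
  above = solve-∀
  below : ∀ v z → -ᶻ (+ 1 +ᶻ z) ≡ + 1 +ᶻ v -ᶻ (+ 2 +ᶻ (v +ᶻ z))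
  below = solve-∀
  at : ∀ {γ x w} (γ<c : γ < c) → (∃₂ λ i j → entry (A γ) i j ≡ x) → x ≡ w →
       ∃ λ γ → ∃₂ λ i j → entry (A (toℕ {c} γ)) i j ≡ w
  at γ<c (i , j , p) x≡w = fromℕ< γ<c , subst (λ γ → ∃₂ λ i j → entry (A γ) i j ≡ _) (sym (toℕ-fromℕ< γ<c)) (i , j , trans p x≡w)
  value : ∀ {v} → (∃ λ z → z < W × v ≡ W + z) ⊎ (∃ λ z → z < W × W ≡ suc (v + z)) →
          ∃ λ γ → ∃₂ λ i j → entry (A (toℕ {c} γ)) i j ≡ + (1 + v * 2) -ᶻ + (c * (m * n))
  value (inj₁ (z , z<W , refl)) with cover z<W
  ... | γ , γ<c , Pγ = at γ<c (proj₁ (attains (A γ) Pγ)) (begin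
    + (1 + z * 2)                            ≡⟨ above (+ (z * 2)) (+ (W * 2)) ⟩
    + (1 + (W * 2 + z * 2)) -ᶻ + (W * 2)     ≡⟨ cong₂ (λ a b → + (1 + a) -ᶻ + b) (sym (ℕ.*-distribʳ-+ 2 W z)) (sym N≡) ⟩
    + (1 + (W + z) * 2) -ᶻ + (c * (m * n))   ∎)
    where open ≡-Reasoning
  value {v} (inj₂ (z , z<W , W≡)) with cover z<W
  ... | γ , γ<c , Pγ = at γ<c (proj₂ (attains (A γ) Pγ)) (begin
    -ᶻ + (1 + z * 2)                             ≡⟨ below (+ (v * 2)) (+ (z * 2)) ⟩
    + (1 + v * 2) -ᶻ + (2 + (v * 2 + z * 2))
      ≡⟨ cong (λ b → + (1 + v * 2) -ᶻ + b) (trans (cong (λ a → suc (suc a)) (sym (ℕ.*-distribʳ-+ 2 v z)))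
           (trans (cong (_* 2) (sym W≡)) (sym N≡))) ⟩
    + (1 + v * 2) -ᶻ + (c * (m * n))             ∎)
    where open ≡-Reasoning

-- Rectangle γ takes the γ-th run of 4Uk consecutive odd numbers.
magicSet-4∣n : ∀ c U k → MagicSet c (U * 2) (k * 4)
magicSet-4∣n c U k = fromRects (c * (U * k * 4)) (size c U k) (λ γ → quads (1 + γ * (U * k * 4) * 2) 2 U k) cover
  where
  size : ∀ c U k → c * (U * 2 * (k * 4)) ≡ c * (U * k * 4) * 2
  size = solve-∀ᴺ
  regroup : ∀ γ s r → 1 + (γ * s + r) * 2 ≡ 1 + γ * s * 2 + r * 2
  regroup = solve-∀ᴺ
  cover : ∀ {z} → z < c * (U * k * 4) →
          ∃ λ γ → γ < c × Progression (1 + γ * (U * k * 4) * 2) 2 (U * k * 4) (1 + z * 2)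
  cover z< with divide c (U * k * 4) z<
  ... | γ , r , γ<c , r< , refl = γ , γ<c , r , r< , regroup γ (U * k * 4) r

-- Twelve consecutive odd numbers β, …, β + 22 split into two sextuples, each of which has two
-- halves of equal sum.
sextuple : ℕ → ℕ → Fin 6 → ℤ
sextuple β 0 0F = + (β + 0)
sextuple β 0 1F = -ᶻ + (β + 2)
sextuple β 0 2F = + (β + 4)
sextuple β 0 3F = -ᶻ + (β + 6)
sextuple β 0 4F = -ᶻ + (β + 8)
sextuple β 0 5F = + (β + 12)
sextuple β 1 0F = + (β + 10)
sextuple β 1 1F = -ᶻ + (β + 14)
sextuple β 1 2F = -ᶻ + (β + 16)
sextuple β 1 3F = + (β + 18)
sextuple β 1 4F = -ᶻ + (β + 20)
sextuple β 1 5F = + (β + 22)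
sextuple β (suc (suc r)) = sextuple (β + 24) r

sextuple-sum : ∀ β r → sum (sextuple β r) ≡ + 0
sextuple-sum β 0 = balance (+ β)
  where
  balance : ∀ b → (b +ᶻ + 0) +ᶻ (-ᶻ (b +ᶻ + 2) +ᶻ ((b +ᶻ + 4) +ᶻ (-ᶻ (b +ᶻ + 6) +ᶻ (-ᶻ (b +ᶻ + 8) +ᶻ ((b +ᶻ + 12) +ᶻ + 0))))) ≡ + 0
  balance = solve-∀
sextuple-sum β 1 = balance (+ β)
  where
  balance : ∀ b → (b +ᶻ + 10) +ᶻ (-ᶻ (b +ᶻ + 14) +ᶻ (-ᶻ (b +ᶻ + 16) +ᶻ ((b +ᶻ + 18) +ᶻ (-ᶻ (b +ᶻ + 20) +ᶻ ((b +ᶻ + 22) +ᶻ + 0))))) ≡ + 0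
  balance = solve-∀
sextuple-sum β (suc (suc r)) = sextuple-sum (β + 24) r

sextuple-cover : ∀ β q {z} → z < q * 12 → ∃ λ r → r < q * 2 × ∃ λ j → ∣ sextuple β r j ∣ ≡ β + z * 2
sextuple-cover β (suc q) {z} z< with split-at 12 z<
... | inj₂ (z′ , z′< , refl) =
  let r , r< , j , p = sextuple-cover (β + 24) q z′<
  in suc (suc r) , s<s (s<s r<) , j , trans p (ℕ.+-assoc β 24 (z′ * 2))
... | inj₁ z<12 = first z z<12
  where
  neg : ∀ i → ∣ -ᶻ + (β + i) ∣ ≡ β + i
  neg i = ℤ.∣-i∣≡∣i∣ (+ (β + i))
  first : ∀ z → z < 12 → ∃ λ r → r < suc q * 2 × ∃ λ j → ∣ sextuple β r j ∣ ≡ β + z * 2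
  first 0  _ = 0 , z<s , 0F , refl
  first 1  _ = 0 , z<s , 1F , neg 2
  first 2  _ = 0 , z<s , 2F , refl
  first 3  _ = 0 , z<s , 3F , neg 6
  first 4  _ = 0 , z<s , 4F , neg 8
  first 5  _ = 1 , s<s z<s , 0F , refl
  first 6  _ = 0 , z<s , 5F , refl
  first 7  _ = 1 , s<s z<s , 1F , neg 14
  first 8  _ = 1 , s<s z<s , 2F , neg 16
  first 9  _ = 1 , s<s z<s , 3F , refl
  first 10 _ = 1 , s<s z<s , 4F , neg 20
  first 11 _ = 1 , s<s z<s , 5F , refl
  first (suc (suc (suc (suc (suc (suc (suc (suc (suc (suc (suc (suc _))))))))))))
        (s<s (s<s (s<s (s<s (s<s (s<s (s<s (s<s (s<s (s<s (s<s (s<s ()))))))))))))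

-- An odd number of sextuples needs an unbalanced one: 7 + 11 = 1 + 3 + 5 + 9.
sextuple₀ : Fin 6 → ℤ
sextuple₀ 0F = -ᶻ + 1
sextuple₀ 1F = -ᶻ + 3
sextuple₀ 2F = -ᶻ + 5
sextuple₀ 3F = + 7
sextuple₀ 4F = -ᶻ + 9
sextuple₀ 5F = + 11

sextuples : ∀ w → ∃ λ (v : ℕ → Fin 6 → ℤ) → (∀ r → sum (v r) ≡ + 0) ×
            (∀ {z} → z < w * 6 → ∃ λ r → r < w × ∃ λ j → ∣ v r j ∣ ≡ 1 + z * 2)
sextuples w with halve w
... | q , inj₁ refl = sextuple 1 , sextuple-sum 1 , λ {z} z< → sextuple-cover 1 q (subst (z <_) (ℕ.*-assoc q 2 6) z<)
... | q , inj₂ refl = v , zero-sum , λ z< → cover (split-at 6 z<)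
  where
  v : ℕ → Fin 6 → ℤ
  v zero    = sextuple₀
  v (suc r) = sextuple 13 r
  zero-sum : ∀ r → sum (v r) ≡ + 0
  zero-sum zero    = refl
  zero-sum (suc r) = sextuple-sum 13 r
  first : ∀ z → z < 6 → ∃ λ j → ∣ sextuple₀ j ∣ ≡ 1 + z * 2
  first 0 _ = 0F , refl
  first 1 _ = 1F , refl
  first 2 _ = 2F , refl
  first 3 _ = 3F , refl
  first 4 _ = 4F , refl
  first 5 _ = 5F , refl
  first (suc (suc (suc (suc (suc (suc _)))))) (s<s (s<s (s<s (s<s (s<s (s<s ()))))))
  cover : ∀ {z} → z < 6 ⊎ (∃ λ z′ → z′ < q * 2 * 6 × z ≡ 6 + z′) →
          ∃ λ r → r < 1 + q * 2 × ∃ λ j → ∣ v r j ∣ ≡ 1 + z * 2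
  cover {z} (inj₁ z<6) = 0 , z<s , first z z<6
  cover (inj₂ (z′ , z′< , refl)) =
    let r , r< , j , p = sextuple-cover 13 q (subst (z′ <_) (ℕ.*-assoc q 2 6) z′<)
    in suc r , s<s r< , j , p

-- Each of the cU two-row strips starts with a sextuple; these use the first 6cU odd numbers, and
-- the quadruples continue from there.
magicSet-4∣n+2 : ∀ c U k → MagicSet c (U * 2) (6 + k * 4)
magicSet-4∣n+2 c U k with sextuples (c * U)
... | v , zero-sum , v-cover = fromRects (c * U * 6 + c * (U * k * 4)) (size c U k)
  (λ γ → vrepeat U (λ u → strip₀ (v (γ * U + u)) (zero-sum (γ * U + u))) ∣∣ quads (first γ) 2 U k)
  (λ z< → cover (split-at (c * U * 6) z<))
  where
  first : ℕ → ℕ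
  first γ = 1 + (c * U * 6 + γ * (U * k * 4)) * 2
  size : ∀ c U k → c * (U * 2 * (6 + k * 4)) ≡ (c * U * 6 + c * (U * k * 4)) * 2
  size = solve-∀ᴺ
  regroup : ∀ a γ s r → 1 + (a + (γ * s + r)) * 2 ≡ 1 + (a + γ * s) * 2 + r * 2
  regroup = solve-∀ᴺ
  cover : ∀ {z} → z < c * U * 6 ⊎ (∃ λ z′ → z′ < c * (U * k * 4) × z ≡ c * U * 6 + z′) → ∃ λ γ → γ < c ×
          (⋃< U (λ u x → ∃ λ j → ∣ v (γ * U + u) j ∣ ≡ x) ∪ Progression (first γ) 2 (U * k * 4)) (1 + z * 2)
  cover (inj₁ z<) with v-cover z<
  ... | r , r< , j , p with divide c U r<
  ... | γ , u , γ<c , u<U , refl = γ , γ<c , inj₁ (u , u<U , j , p)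
  cover (inj₂ (z′ , z′< , refl)) with divide c (U * k * 4) z′<
  ... | γ , r , γ<c , r< , refl = γ , γ<c , inj₂ (r , r< , regroup (c * U * 6) γ (U * k * 4) r)

-- Kotzig arrays

-- Column γ of a Kotzig array: for γ ≤ 2C each row passes once through -C, ..., C, while each column
-- sums to 0. Row 0 increases; rows 1 and 2 each interleave two decreasing runs.
kotzig : ℕ → ℕ → Fin 3 → ℤ
kotzig C 0 0F = -ᶻ + C
kotzig C 0 1F = + 0
kotzig C 0 2F = + C
kotzig C 1 0F = + 1 -ᶻ + C
kotzig C 1 1F = + C
kotzig C 1 2F = -ᶻ + 1
kotzig C (suc (suc γ)) 0F = + 2 +ᶻ kotzig C γ 0F
kotzig C (suc (suc γ)) 1F = kotzig C γ 1F -ᶻ + 1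
kotzig C (suc (suc γ)) 2F = kotzig C γ 2F -ᶻ + 1

kotzig-sum : ∀ C γ → kotzig C γ 0F +ᶻ (kotzig C γ 1F +ᶻ kotzig C γ 2F) ≡ + 0
kotzig-sum C 0 = balance (+ C)
  where
  balance : ∀ c → -ᶻ c +ᶻ (+ 0 +ᶻ c) ≡ + 0
  balance = solve-∀
kotzig-sum C 1 = balance (+ C)
  where
  balance : ∀ c → (+ 1 -ᶻ c) +ᶻ (c +ᶻ -ᶻ + 1) ≡ + 0
  balance = solve-∀
kotzig-sum C (suc (suc γ)) = trans (balance (kotzig C γ 0F) (kotzig C γ 1F) (kotzig C γ 2F)) (kotzig-sum C γ)
  where
  balance : ∀ x y z → (+ 2 +ᶻ x) +ᶻ ((y -ᶻ + 1) +ᶻ (z -ᶻ + 1)) ≡ x +ᶻ (y +ᶻ z)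
  balance = solve-∀

kotzig₀ : ∀ C γ → kotzig C γ 0F ≡ + γ -ᶻ + C
kotzig₀ C 0 = sym (ℤ.+-identityˡ (-ᶻ + C))
kotzig₀ C 1 = refl
kotzig₀ C (suc (suc γ)) = trans (cong (+ 2 +ᶻ_) (kotzig₀ C γ)) (sym (ℤ.+-assoc (+ 2) (+ γ) (-ᶻ + C)))

pred-shift : ∀ c j → (c -ᶻ j) -ᶻ + 1 ≡ c -ᶻ (+ 1 +ᶻ j)
pred-shift = solve-∀

kotzig₁-even : ∀ C j → kotzig C (j * 2) 1F ≡ + 0 -ᶻ + j
kotzig₁-even C zero    = refl
kotzig₁-even C (suc j) = trans (cong (_-ᶻ + 1) (kotzig₁-even C j)) (pred-shift (+ 0) (+ j))

kotzig₁-odd : ∀ C j → kotzig C (1 + j * 2) 1F ≡ + C -ᶻ + j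
kotzig₁-odd C zero    = sym (ℤ.+-identityʳ (+ C))
kotzig₁-odd C (suc j) = trans (cong (_-ᶻ + 1) (kotzig₁-odd C j)) (pred-shift (+ C) (+ j))

kotzig₂-even : ∀ C j → kotzig C (j * 2) 2F ≡ + C -ᶻ + j
kotzig₂-even C zero    = sym (ℤ.+-identityʳ (+ C))
kotzig₂-even C (suc j) = trans (cong (_-ᶻ + 1) (kotzig₂-even C j)) (pred-shift (+ C) (+ j))

kotzig₂-odd : ∀ C j → kotzig C (1 + j * 2) 2F ≡ -ᶻ + 1 -ᶻ + j
kotzig₂-odd C zero    = refl
kotzig₂-odd C (suc j) = trans (cong (_-ᶻ + 1) (kotzig₂-odd C j)) (pred-shift (-ᶻ + 1) (+ j))

even-index : ∀ {j C} → j ≤ C → j * 2 < 1 + C * 2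
even-index j≤C = s≤s (ℕ.*-monoˡ-≤ 2 j≤C)

odd-index : ∀ {j C} → j < C → 1 + j * 2 < 1 + C * 2
odd-index j<C = s≤s (ℕ.<⇒≤ (ℕ.*-monoˡ-≤ 2 j<C))

-- The closed forms are inverted: in row 1 the values up to 0 come from even γ and the positive ones
-- from odd γ; in row 2 the negative values come from odd γ and the others from even γ.
kotzig-onto : ∀ C τ {b} → b < 1 + C * 2 → ∃ λ γ → γ < 1 + C * 2 × kotzig C γ τ ≡ + b -ᶻ + C
kotzig-onto C 0F {b} b< = b , b< , kotzig₀ C b
kotzig-onto C 1F {b} b< with b ℕ.≤? C
... | yes b≤C with ℕ.m≤n⇒∃[o]m+o≡n b≤C
...   | j , refl = j * 2 , even-index (ℕ.m≤n+m j b) , trans (kotzig₁-even C j) (ring (+ b) (+ j))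
  where
  ring : ∀ b j → + 0 -ᶻ j ≡ b -ᶻ (b +ᶻ j)
  ring = solve-∀
kotzig-onto C 1F {b} b< | no b≰C with ℕ.m≤n⇒∃[o]m+o≡n (ℕ.≰⇒> b≰C)
... | o , refl with ℕ.m≤n⇒∃[o]m+o≡n {suc o} {C} (ℕ.+-cancelˡ-≤ C (suc o) C
                      (subst₂ _≤_ (sym (ℕ.+-suc C o)) (j*2≡j+j C) (ℕ.≤-pred b<)))
... | j , refl = 1 + j * 2 , odd-index (s≤s (ℕ.m≤n+m j o)) , trans (kotzig₁-odd C j) (ring (+ o) (+ j))
  where
  ring : ∀ o j → (+ 1 +ᶻ o +ᶻ j) -ᶻ j ≡ (+ 1 +ᶻ (+ 1 +ᶻ o +ᶻ j) +ᶻ o) -ᶻ (+ 1 +ᶻ o +ᶻ j)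
  ring = solve-∀
kotzig-onto C 2F {b} b< with b ℕ.<? C
... | yes b<C with ℕ.m≤n⇒∃[o]m+o≡n b<C
...   | j , refl = 1 + j * 2 , odd-index (s≤s (ℕ.m≤n+m j b)) , trans (kotzig₂-odd C j) (ring (+ b) (+ j))
  where
  ring : ∀ b j → -ᶻ + 1 -ᶻ j ≡ b -ᶻ (+ 1 +ᶻ b +ᶻ j)
  ring = solve-∀
kotzig-onto C 2F {b} b< | no b≮C with ℕ.m≤n⇒∃[o]m+o≡n (ℕ.≮⇒≥ b≮C)
... | o , refl with ℕ.m≤n⇒∃[o]m+o≡n {o} {C} (ℕ.+-cancelˡ-≤ C o C (subst (C + o ≤_) (j*2≡j+j C) (ℕ.≤-pred b<)))
... | j , refl = j * 2 , even-index (ℕ.m≤n+m j o) , trans (kotzig₂-even C j) (ring (+ o) (+ j))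
  where
  ring : ∀ o j → (o +ᶻ j) -ᶻ j ≡ (o +ᶻ j +ᶻ o) -ᶻ (o +ᶻ j)
  ring = solve-∀

-- The range -C, ..., C is symmetric, so a negated row is treated by passing from b to b′ = 2C - b.
kotzig-onto± : ∀ C τ s {b} → b < 1 + C * 2 → ∃ λ γ → γ < 1 + C * 2 × flip± (kotzig C γ τ) s ≡ + b -ᶻ + C
kotzig-onto± C τ 0F b< = kotzig-onto C τ b<
kotzig-onto± C τ 1F {b} b< with ℕ.m≤n⇒∃[o]m+o≡n (ℕ.≤-pred b<)
... | b′ , eq with kotzig-onto C τ {b′} (s≤s (subst (b′ ≤_) eq (ℕ.m≤n+m b′ b)))
... | γ , γ< , p = γ , γ< , (begin
  -ᶻ kotzig C γ τ                         ≡⟨ cong -ᶻ_ p ⟩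
  -ᶻ (+ b′ -ᶻ + C)                        ≡⟨ ring (+ b) (+ b′) (+ C) ⟩
  + b -ᶻ + C +ᶻ (+ (C + C) -ᶻ + (b + b′))  ≡⟨ cong (λ z → + b -ᶻ + C +ᶻ (+ (C + C) -ᶻ + z)) (trans eq (j*2≡j+j C)) ⟩
  + b -ᶻ + C +ᶻ (+ (C + C) -ᶻ + (C + C))   ≡⟨ cong (+ b -ᶻ + C +ᶻ_) (ℤ.+-inverseʳ (+ (C + C))) ⟩
  + b -ᶻ + C +ᶻ + 0                        ≡⟨ ℤ.+-identityʳ _ ⟩
  + b -ᶻ + C                              ∎)
  where
  open ≡-Reasoning
  ring : ∀ b b′ C → -ᶻ (b′ -ᶻ C) ≡ b -ᶻ C +ᶻ (C +ᶻ C -ᶻ (b +ᶻ b′))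
  ring = solve-∀

-- Copying an odd rectangle an odd number of times

-- A Kotzig triple with sum 0 is spread over the rectangle: a Latin square in the 3 × 3 corner,
-- opposite signs in the pairs of further rows and columns. Added to c times a magic rectangle,
-- it separates c copies of the latter.

Class : Set
Class = Fin 3 ⊎ Fin 2

parity : ∀ M → Fin (M * 2) → Fin 2
parity (suc M) zero          = 0F
parity (suc M) (suc zero)    = 1F
parity (suc M) (suc (suc i)) = parity M i

class : ∀ M → Fin (3 + M * 2) → Class
class M 0F                  = inj₁ 0F
class M 1F                  = inj₁ 1F
class M 2F                  = inj₁ 2F
class M (suc (suc (suc i))) = inj₂ (parity M i)

sum-parity : ∀ M (g : Fin 2 → ℤ) → g 0F +ᶻ g 1F ≡ + 0 → sum (λ i → g (parity M i)) ≡ + 0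
sum-parity zero    g g≡0 = refl
sum-parity (suc M) g g≡0 = trans (sym (ℤ.+-assoc (g 0F) (g 1F) _)) (cong₂ _+ᶻ_ g≡0 (sum-parity M g g≡0))

sum-class : ∀ M (g : Class → ℤ) → g (inj₁ 0F) +ᶻ (g (inj₁ 1F) +ᶻ g (inj₁ 2F)) ≡ + 0 →
            g (inj₂ 0F) +ᶻ g (inj₂ 1F) ≡ + 0 → sum (λ i → g (class M i)) ≡ + 0
sum-class M g g₃≡0 g₂≡0 = begin
  g (inj₁ 0F) +ᶻ (g (inj₁ 1F) +ᶻ (g (inj₁ 2F) +ᶻ sum (λ i → g (inj₂ (parity M i)))))
    ≡⟨ cong (λ z → g (inj₁ 0F) +ᶻ (g (inj₁ 1F) +ᶻ (g (inj₁ 2F) +ᶻ z))) (sum-parity M (g ∘ inj₂) g₂≡0) ⟩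
  g (inj₁ 0F) +ᶻ (g (inj₁ 1F) +ᶻ (g (inj₁ 2F) +ᶻ + 0))
    ≡⟨ cong (λ z → g (inj₁ 0F) +ᶻ (g (inj₁ 1F) +ᶻ z)) (ℤ.+-identityʳ (g (inj₁ 2F))) ⟩
  g (inj₁ 0F) +ᶻ (g (inj₁ 1F) +ᶻ g (inj₁ 2F))
    ≡⟨ g₃≡0 ⟩
  + 0 ∎
  where open ≡-Reasoning

latin : Fin 3 → Fin 3 → Fin 3
latin 0F j  = j
latin 1F 0F = 1F
latin 1F 1F = 2F
latin 1F 2F = 0F
latin 2F 0F = 2F
latin 2F 1F = 0F
latin 2F 2F = 1F

Cell : Set
Cell = Fin 3 × Fin 2

-- A cell (τ, s) stands for κ τ with sign + or - according to s; outside the first three rows and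
-- columns ±κ₀ forms a checkerboard. Symmetry of this table reduces column sums to row sums.
cell : Class → Class → Cell
cell (inj₁ i)  (inj₁ j)  = latin i j , 0F
cell (inj₁ i)  (inj₂ s)  = i , s
cell (inj₂ s)  (inj₁ j)  = j , s
cell (inj₂ 0F) (inj₂ t)  = 0F , t
cell (inj₂ 1F) (inj₂ 0F) = 0F , 1F
cell (inj₂ 1F) (inj₂ 1F) = 0F , 0F

cell-sym : ∀ x y → cell x y ≡ cell y x
cell-sym (inj₁ 0F) (inj₁ 0F) = refl
cell-sym (inj₁ 0F) (inj₁ 1F) = refl
cell-sym (inj₁ 0F) (inj₁ 2F) = refl
cell-sym (inj₁ 1F) (inj₁ 0F) = refl
cell-sym (inj₁ 1F) (inj₁ 1F) = refl
cell-sym (inj₁ 1F) (inj₁ 2F) = refl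
cell-sym (inj₁ 2F) (inj₁ 0F) = refl
cell-sym (inj₁ 2F) (inj₁ 1F) = refl
cell-sym (inj₁ 2F) (inj₁ 2F) = refl
cell-sym (inj₁ _)  (inj₂ _)  = refl
cell-sym (inj₂ _)  (inj₁ _)  = refl
cell-sym (inj₂ 0F) (inj₂ 0F) = refl
cell-sym (inj₂ 0F) (inj₂ 1F) = refl
cell-sym (inj₂ 1F) (inj₂ 0F) = refl
cell-sym (inj₂ 1F) (inj₂ 1F) = refl

module _ (κ : Fin 3 → ℤ) (∑κ≡0 : κ 0F +ᶻ (κ 1F +ᶻ κ 2F) ≡ + 0) where

  valueAt : Cell → ℤ
  valueAt (τ , s) = flip± (κ τ) s

  pattern-sum : ∀ M x → sum (λ i → valueAt (cell x (class M i))) ≡ + 0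
  pattern-sum M x = sum-class M (valueAt ∘ cell x) (three x) (two x)
    where
    cancel : ∀ a → a +ᶻ -ᶻ a ≡ + 0
    cancel = ℤ.+-inverseʳ
    cancel′ : ∀ a → -ᶻ a +ᶻ a ≡ + 0
    cancel′ = ℤ.+-inverseˡ
    rotate : ∀ a b c → b +ᶻ (c +ᶻ a) ≡ a +ᶻ (b +ᶻ c)
    rotate = solve-∀
    rotate′ : ∀ a b c → c +ᶻ (a +ᶻ b) ≡ a +ᶻ (b +ᶻ c)
    rotate′ = solve-∀
    negate : ∀ a b c → -ᶻ a +ᶻ (-ᶻ b +ᶻ -ᶻ c) ≡ -ᶻ (a +ᶻ (b +ᶻ c))
    negate = solve-∀
    three : ∀ x → valueAt (cell x (inj₁ 0F)) +ᶻ (valueAt (cell x (inj₁ 1F)) +ᶻ valueAt (cell x (inj₁ 2F))) ≡ + 0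
    three (inj₁ 0F) = ∑κ≡0
    three (inj₁ 1F) = trans (rotate (κ 0F) (κ 1F) (κ 2F)) ∑κ≡0
    three (inj₁ 2F) = trans (rotate′ (κ 0F) (κ 1F) (κ 2F)) ∑κ≡0
    three (inj₂ 0F) = ∑κ≡0
    three (inj₂ 1F) = trans (negate (κ 0F) (κ 1F) (κ 2F)) (cong -ᶻ_ ∑κ≡0)
    two : ∀ x → valueAt (cell x (inj₂ 0F)) +ᶻ valueAt (cell x (inj₂ 1F)) ≡ + 0
    two (inj₁ i)  = cancel (κ i)
    two (inj₂ 0F) = cancel (κ 0F)
    two (inj₂ 1F) = cancel′ (κ 0F)

  pattern-sumʳ : ∀ M x → sum (λ i → valueAt (cell (class M i) x)) ≡ + 0
  pattern-sumʳ M x = trans (sum-cong-≗ λ i → cong valueAt (cell-sym (class M i) x)) (pattern-sum M x)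

sum-affine : ∀ {n} a b (f g : Fin n → ℤ) → sum f ≡ + 0 → sum g ≡ + 0 →
             sum (λ i → a *ᶻ (b *ᶻ f i +ᶻ g i)) ≡ + 0
sum-affine a b f g f≡0 g≡0 = begin
  sum (λ i → a *ᶻ (b *ᶻ f i +ᶻ g i))        ≡⟨ *-distribˡ-sum a (λ i → b *ᶻ f i +ᶻ g i) ⟨
  a *ᶻ sum (λ i → b *ᶻ f i +ᶻ g i)          ≡⟨ cong (a *ᶻ_) (∑-distrib-+ (λ i → b *ᶻ f i) g) ⟩
  a *ᶻ (sum (λ i → b *ᶻ f i) +ᶻ sum g)      ≡⟨ cong₂ (λ x y → a *ᶻ (x +ᶻ y)) (trans (sym (*-distribˡ-sum b f)) (cong (b *ᶻ_) f≡0)) g≡0 ⟩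
  a *ᶻ (b *ᶻ + 0 +ᶻ + 0)                    ≡⟨ vanish a b ⟩
  + 0                                       ∎
  where
  open ≡-Reasoning
  vanish : ∀ a b → a *ᶻ (b *ᶻ + 0 +ᶻ + 0) ≡ + 0
  vanish = solve-∀

-- With v = ac + b, the digit a selects the cell of `V` and the digit b selects the copy, because at
-- a fixed cell the Kotzig entry runs through -C, ..., C as γ varies. The factor 2 is the doubling
-- in `MagicSet`.
copies : ∀ C M Q {H} → (3 + M * 2) * (3 + Q * 2) ≡ 1 + H * 2 → Rect₀ (3 + M * 2) (3 + Q * 2) (_≤ H) →
         MagicSet (1 + C * 2) (3 + M * 2) (3 + Q * 2)
copies C M Q {H} mn≡ V = record
  { entry   = λ γ i j → + 2 *ᶻ (+ c *ᶻ entry V i j +ᶻ Φ (toℕ γ) i j)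
  ; row-sum = λ γ i → sum-affine (+ 2) (+ c) (entry V i) (Φ (toℕ γ) i) (row-sum V i)
                        (pattern-sum (kotzig C (toℕ γ)) (kotzig-sum C (toℕ γ)) Q (class M i))
  ; col-sum = λ γ j → sum-affine (+ 2) (+ c) (λ i → entry V i j) (λ i → Φ (toℕ γ) i j) (col-sum V j)
                        (pattern-sumʳ (kotzig C (toℕ γ)) (kotzig-sum C (toℕ γ)) M (class Q j))
  ; attains = value
  }
  where
  c = 1 + C * 2
  m = 3 + M * 2
  n = 3 + Q * 2
  Φ : ℕ → Fin m → Fin n → ℤ
  Φ γ i j = valueAt (kotzig C γ) (kotzig-sum C γ) (cell (class M i) (class Q j))
  V-onto : ∀ {a} → a < 1 + H * 2 → ∃₂ λ i j → entry V i j ≡ + a -ᶻ + H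
  V-onto {a} a< with a ℕ.<? H
  ... | yes a<H with ℕ.m≤n⇒∃[o]m+o≡n (ℕ.<⇒≤ a<H)
  ...   | x , eq with attains V (subst (x ≤_) eq (ℕ.m≤n+m x a))
  ...     | _ , (i , j , p) = i , j , trans p (trans (ring (+ a) (+ x)) (cong (λ z → + a -ᶻ + z) eq))
    where
    ring : ∀ a x → -ᶻ x ≡ a -ᶻ (a +ᶻ x)
    ring = solve-∀
  V-onto {a} a< | no a≮H with ℕ.m≤n⇒∃[o]m+o≡n (ℕ.≮⇒≥ a≮H)
  ... | x , eq with attains V (ℕ.+-cancelˡ-≤ H x H (subst₂ _≤_ (sym eq) (j*2≡j+j H) (ℕ.≤-pred a<)))
  ...   | (i , j , p) , _ = i , j , trans p (trans (ring (+ H) (+ x)) (cong (λ z → + z -ᶻ + H) eq))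
    where
    ring : ∀ h x → x ≡ h +ᶻ x -ᶻ h
    ring = solve-∀
  -- The constants match because c = 1 + 2C and mn = 1 + 2H give c(mn) = 1 + 2C + 2cH.
  combineDigits : ∀ a b → + 2 *ᶻ (+ c *ᶻ (+ a -ᶻ + H) +ᶻ (+ b -ᶻ + C)) ≡ + (1 + (a * c + b) * 2) -ᶻ + (c * (m * n))
  combineDigits a b = begin
    + 2 *ᶻ (+ c *ᶻ (+ a -ᶻ + H) +ᶻ (+ b -ᶻ + C))
      ≡⟨ cong (λ z → + 2 *ᶻ (z *ᶻ (+ a -ᶻ + H) +ᶻ (+ b -ᶻ + C))) c≡ ⟩
    + 2 *ᶻ ((+ 1 +ᶻ + C *ᶻ + 2) *ᶻ (+ a -ᶻ + H) +ᶻ (+ b -ᶻ + C))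
      ≡⟨ ring (+ a) (+ b) (+ C) (+ H) ⟩
    + 1 +ᶻ (+ a *ᶻ (+ 1 +ᶻ + C *ᶻ + 2) +ᶻ + b) *ᶻ + 2 -ᶻ (+ 1 +ᶻ + C *ᶻ + 2) *ᶻ (+ 1 +ᶻ + H *ᶻ + 2)
      ≡⟨ cong₂ (λ y z → + 1 +ᶻ (+ a *ᶻ y +ᶻ + b) *ᶻ + 2 -ᶻ y *ᶻ z) (sym c≡) (cong (+ 1 +ᶻ_) (sym (ℤ.pos-* H 2))) ⟩
    + 1 +ᶻ (+ a *ᶻ + c +ᶻ + b) *ᶻ + 2 -ᶻ + c *ᶻ + (1 + H * 2)
      ≡⟨ cong₂ (λ y z → + 1 +ᶻ y -ᶻ z)
           (trans (cong (λ y → (y +ᶻ + b) *ᶻ + 2) (sym (ℤ.pos-* a c))) (sym (ℤ.pos-* (a * c + b) 2)))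
           (trans (sym (ℤ.pos-* c (1 + H * 2))) (cong (λ z → + (c * z)) (sym mn≡))) ⟩
    + (1 + (a * c + b) * 2) -ᶻ + (c * (m * n)) ∎
    where
    open ≡-Reasoning
    c≡ : + c ≡ + 1 +ᶻ + C *ᶻ + 2
    c≡ = cong (+ 1 +ᶻ_) (ℤ.pos-* C 2)
    ring : ∀ a b C H → + 2 *ᶻ ((+ 1 +ᶻ C *ᶻ + 2) *ᶻ (a -ᶻ H) +ᶻ (b -ᶻ C)) ≡
           + 1 +ᶻ (a *ᶻ (+ 1 +ᶻ C *ᶻ + 2) +ᶻ b) *ᶻ + 2 -ᶻ (+ 1 +ᶻ C *ᶻ + 2) *ᶻ (+ 1 +ᶻ H *ᶻ + 2)
    ring = solve-∀
  value : ∀ {v} → v < c * (m * n) → ∃ λ γ → ∃₂ λ i j →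
          + 2 *ᶻ (+ c *ᶻ entry V i j +ᶻ Φ (toℕ {c} γ) i j) ≡ + (1 + v * 2) -ᶻ + (c * (m * n))
  value {v} v< = place (divide (1 + H * 2) c (subst (v <_) (trans (ℕ.*-comm c (m * n)) (cong (_* c) mn≡)) v<))
    where
    place : ∀ {v} → (∃₂ λ a b → a < 1 + H * 2 × b < c × v ≡ a * c + b) → ∃ λ γ → ∃₂ λ i j →
            + 2 *ᶻ (+ c *ᶻ entry V i j +ᶻ Φ (toℕ {c} γ) i j) ≡ + (1 + v * 2) -ᶻ + (c * (m * n))
    place (a , b , a< , b< , refl) =
      let i , j , p  = V-onto a<
          τ , s      = cell (class M i) (class Q j)
          γ , γ< , q = kotzig-onto± C τ s b<
      in fromℕ< γ< , i , j ,
         trans (cong₂ (λ x y → + 2 *ᶻ (+ c *ᶻ x +ᶻ y)) p (trans (cong (λ g → Φ g i j) (toℕ-fromℕ< γ<)) q))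
               (combineDigits a b)

magicSet-odd : ∀ C M Q → 1 ≤ Q → MagicSet (1 + C * 2) (3 + M * 2) (3 + Q * 2)
magicSet-odd C M Q 1≤Q = copies C M Q (size M Q) (oddRect M Q 1≤Q)
  where
  size : ∀ M Q → (3 + M * 2) * (3 + Q * 2) ≡ 1 + (4 + 3 * (M + Q) + 2 * (M * Q)) * 2
  size = solve-∀ᴺ

-- Sums over graphs

ind : ∀ {P : Set} → Dec P → ℤ
ind P? = if does P? then + 1 else + 0

ind-× : ∀ {P Q : Set} (P? : Dec P) (Q? : Dec Q) → ind (P? ×-dec Q?) ≡ ind P? *ᶻ ind Q?
ind-× (yes _) (yes _) = refl
ind-× (yes _) (no _)  = refl
ind-× (no _)  _       = refl

sum-const : ∀ n c → sum {n} (λ _ → c) ≡ + n *ᶻ c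
sum-const zero    c = refl
sum-const (suc n) c = trans (cong (c +ᶻ_) (sum-const n c)) (ring c (+ n))
  where
  ring : ∀ c n → c +ᶻ n *ᶻ c ≡ (+ 1 +ᶻ n) *ᶻ c
  ring = solve-∀

sum-select : ∀ {n} (i : Fin n) (f : Fin n → ℤ) → sum (λ k → ind (i ≟ k) *ᶻ f k) ≡ f i
sum-select zero    f = trans (cong₂ _+ᶻ_ (ℤ.*-identityˡ (f zero)) (sum-zero {f = λ k → + 0 *ᶻ f (suc k)} λ _ → refl)) (ℤ.+-identityʳ (f zero))
sum-select (suc i) f = trans (ℤ.+-identityˡ _) (sum-select i (f ∘ suc))

∑≠ : ∀ {n} → Fin n → (Fin n → ℤ) → ℤ
∑≠ i f = sum f -ᶻ f i

∑≠-cong : ∀ {n} (i : Fin n) {f g : Fin n → ℤ} → (∀ k → f k ≡ g k) → ∑≠ i f ≡ ∑≠ i g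
∑≠-cong i f≗g = cong₂ _-ᶻ_ (sum-cong-≗ f≗g) (f≗g i)

sum-≢ : ∀ {n} (i : Fin n) (f : Fin n → ℤ) → sum (λ k → ind (¬? (i ≟ k)) *ᶻ f k) ≡ ∑≠ i f
sum-≢ i f = begin
  A                                ≡⟨ add-sub A (f i) ⟩
  f i +ᶻ A -ᶻ f i                  ≡⟨ cong (λ z → z +ᶻ A -ᶻ f i) (sum-select i f) ⟨
  sum (λ k → ind (i ≟ k) *ᶻ f k) +ᶻ A -ᶻ f i
    ≡⟨ cong (_-ᶻ f i) (∑-distrib-+ (λ k → ind (i ≟ k) *ᶻ f k) _) ⟨
  sum (λ k → ind (i ≟ k) *ᶻ f k +ᶻ ind (¬? (i ≟ k)) *ᶻ f k) -ᶻ f i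
    ≡⟨ cong (_-ᶻ f i) (sum-cong-≗ λ k → either (i ≟ k) (f k)) ⟩
  sum f -ᶻ f i                     ∎
  where
  open ≡-Reasoning
  A = sum (λ k → ind (¬? (i ≟ k)) *ᶻ f k)
  add-sub : ∀ a x → a ≡ x +ᶻ a -ᶻ x
  add-sub = solve-∀
  one-zero : ∀ x → + 1 *ᶻ x +ᶻ + 0 *ᶻ x ≡ x
  one-zero = solve-∀
  zero-one : ∀ x → + 0 *ᶻ x +ᶻ + 1 *ᶻ x ≡ x
  zero-one = solve-∀
  either : ∀ {P : Set} (P? : Dec P) x → ind P? *ᶻ x +ᶻ ind (¬? P?) *ᶻ x ≡ x
  either (yes _) x = one-zero x
  either (no _)  x = zero-one x

sum-remQuot : ∀ m n (g : Fin m × Fin n → ℤ) → sum (λ k → g (remQuot {m} n k)) ≡ sum λ i → sum λ j → g (i , j)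
sum-remQuot zero    n g = refl
sum-remQuot (suc m) n g = begin
  sum (λ k → g (remQuot {suc m} n k))
    ≡⟨ sum-cong-≗ row-or-rest ⟩
  sum ((λ j → g (zero , j)) ++ (λ k → g (map₁ suc (remQuot {m} n k))))
    ≡⟨ sum-++ (λ j → g (zero , j)) _ ⟩
  sum (λ j → g (zero , j)) +ᶻ sum (λ k → g (map₁ suc (remQuot {m} n k)))
    ≡⟨ cong (sum (λ j → g (zero , j)) +ᶻ_) (sum-remQuot m n (g ∘ map₁ suc)) ⟩
  sum (λ i → sum λ j → g (i , j)) ∎
  where
  open ≡-Reasoning
  row-or-rest : ∀ k → g (remQuot {suc m} n k) ≡ ((λ j → g (zero , j)) ++ (λ k → g (map₁ suc (remQuot {m} n k)))) k
  row-or-rest k with splitAt n k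
  ... | inj₁ _ = refl
  ... | inj₂ _ = refl

∑ᵛ : (G : Graph) → (Vertex G → ℤ) → ℤ
∑ᵛ G f = sum (f ∘ Inverse.from (finite G))

∑ᵛ-cong : ∀ G {f g : Vertex G → ℤ} → (∀ x → f x ≡ g x) → ∑ᵛ G f ≡ ∑ᵛ G g
∑ᵛ-cong G f≗g = sum-cong-≗ λ k → f≗g (Inverse.from (finite G) k)

∑ᵛ-⊠ : ∀ G K f → ∑ᵛ (G ⊠ K) f ≡ ∑ᵛ G λ x → ∑ᵛ K λ y → f (x , y)
∑ᵛ-⊠ G K f = sum-remQuot (order G) (order K) λ (k , l) → f (Inverse.from (finite G) k , Inverse.from (finite K) l)

∑ᵛ-·H : ∀ a n p f → ∑ᵛ (a · H n p) f ≡ sum λ α → sum λ i → sum λ s → f (α , i , s)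
∑ᵛ-·H a n p f = trans (sum-remQuot a (p * n) λ (α , k) → f (α , Inverse.from (finite (H n p)) k))
                      (sum-cong-≗ λ α → sum-remQuot p n λ x → f (α , x))

-- Neighbour sums in the strong product

∑~ : (G : Graph) → Vertex G → (Vertex G → ℤ) → ℤ
∑~ G x f = ∑ᵛ G λ y → ind (_~?_ G x y) *ᶻ f y

sum-filter : ∀ {A B : Set} {P : Pred B 0ℓ} (P? : Decidable P) (f : B → ℕ) (g : A → B) {n} (h : Fin n → A) →
             + List.sum (map f (filter P? (map g (tabulate h)))) ≡ sum λ k → ind (P? (g (h k))) *ᶻ + f (g (h k))
sum-filter P? f g {zero}  h = refl
sum-filter P? f g {suc n} h with P? (g (h zero))
... | yes _ = cong₂ _+ᶻ_ (sym (ℤ.*-identityˡ (+ f (g (h zero))))) (sum-filter P? f g (h ∘ suc))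
... | no  _ = trans (sum-filter P? f g (h ∘ suc)) (sym (ℤ.+-identityˡ _))

neighbour-sum : ∀ G (f : Vertex G → ℕ) x → + List.sum (map f (neighbours G x)) ≡ ∑~ G x (+_ ∘ f)
neighbour-sum G f x = sum-filter (_~?_ G x) f (Inverse.from (finite G)) (λ k → k)

∑ᵛ-select : ∀ G x f → ∑ᵛ G (λ y → ind (Graph._≟_ G x y) *ᶻ f y) ≡ f x
∑ᵛ-select G x f = begin
  sum (λ k → ind (to x ≟ to (from k)) *ᶻ f (from k))   ≡⟨ sum-cong-≗ (λ k → cong (λ l → ind (to x ≟ l) *ᶻ f (from k)) (strictlyInverseˡ k)) ⟩
  sum (λ k → ind (to x ≟ k) *ᶻ f (from k))             ≡⟨ sum-select (to x) (f ∘ from) ⟩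
  f (from (to x))                                      ≡⟨ cong f (strictlyInverseʳ x) ⟩
  f x                                                  ∎
  where
  open ≡-Reasoning
  open Inverse (finite G)

∑~-·H : ∀ a n p α i s f → ∑~ (a · H n p) (α , i , s) f ≡ ∑≠ i λ i′ → sum λ s′ → f (α , i′ , s′)
∑~-·H a n p α i s f = begin
  ∑~ (a · H n p) (α , i , s) f
    ≡⟨ ∑ᵛ-·H a n p _ ⟩
  (sum λ α′ → sum λ i′ → sum λ s′ → ind ((α ≟ α′) ×-dec ¬? (i ≟ i′)) *ᶻ f (α′ , i′ , s′))
    ≡⟨ (sum-cong-≗ λ α′ → sum-cong-≗ λ i′ → trans
         (sum-cong-≗ λ s′ → trans (cong (_*ᶻ f (α′ , i′ , s′)) (ind-× (α ≟ α′) (¬? (i ≟ i′)))) (ℤ.*-assoc (ind (α ≟ α′)) _ _))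
         (sym (trans (cong (ind (α ≟ α′) *ᶻ_) (*-distribˡ-sum {n} (ind (¬? (i ≟ i′))) _)) (*-distribˡ-sum {n} (ind (α ≟ α′)) _)))) ⟩
  (sum λ α′ → sum λ i′ → ind (α ≟ α′) *ᶻ (ind (¬? (i ≟ i′)) *ᶻ sum λ s′ → f (α′ , i′ , s′)))
    ≡⟨ (sum-cong-≗ λ α′ → trans (sym (*-distribˡ-sum {p} (ind (α ≟ α′)) _))
         (cong (ind (α ≟ α′) *ᶻ_) (sum-≢ i _))) ⟩
  (sum λ α′ → ind (α ≟ α′) *ᶻ ∑≠ i λ i′ → sum λ s′ → f (α′ , i′ , s′))
    ≡⟨ sum-select α _ ⟩
  (∑≠ i λ i′ → sum λ s′ → f (α , i′ , s′)) ∎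
  where open ≡-Reasoning

-- Irreflexivity makes the three alternatives of strong adjacency mutually exclusive, so their
-- indicators add.
ind-⊠ : ∀ {P Q R S : Set} (P? : Dec P) (Q? : Dec Q) (R? : Dec R) (S? : Dec S) → (P → ¬ R) → (S → ¬ Q) →
        ind ((P? ×-dec Q?) ⊎-dec (S? ×-dec R?) ⊎-dec (R? ×-dec Q?)) ≡
        ind P? *ᶻ ind Q? +ᶻ (ind R? *ᶻ ind S? +ᶻ ind R? *ᶻ ind Q?)
ind-⊠ (yes p) _       (yes r) _       ¬R _ = ⊥-elim (¬R p r)
ind-⊠ _       (yes q) _       (yes s) _ ¬Q = ⊥-elim (¬Q s q)
ind-⊠ (yes _) (yes _) (no _)  (no _)  _ _ = refl
ind-⊠ (yes _) (no _)  (no _)  (yes _) _ _ = refl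
ind-⊠ (yes _) (no _)  (no _)  (no _)  _ _ = refl
ind-⊠ (no _)  (yes _) (yes _) (no _)  _ _ = refl
ind-⊠ (no _)  (yes _) (no _)  (no _)  _ _ = refl
ind-⊠ (no _)  (no _)  (yes _) (yes _) _ _ = refl
ind-⊠ (no _)  (no _)  (yes _) (no _)  _ _ = refl
ind-⊠ (no _)  (no _)  (no _)  (yes _) _ _ = refl
ind-⊠ (no _)  (no _)  (no _)  (no _)  _ _ = refl

∑~-⊠ : ∀ G K x y f → ∑~ (G ⊠ K) (x , y) f ≡
       ∑~ K y (λ y′ → f (x , y′)) +ᶻ (∑~ G x (λ x′ → f (x′ , y)) +ᶻ ∑~ G x (λ x′ → ∑~ K y λ y′ → f (x′ , y′)))
∑~-⊠ G K x y f = begin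
  ∑~ (G ⊠ K) (x , y) f
    ≡⟨ ∑ᵛ-⊠ G K (λ z → ind (_~?_ (G ⊠ K) (x , y) z) *ᶻ f z) ⟩
  (∑ᵛ G λ x′ → ∑ᵛ K λ y′ → ind (_~?_ (G ⊠ K) (x , y) (x′ , y′)) *ᶻ f (x′ , y′))
    ≡⟨ (∑ᵛ-cong G λ x′ → trans (∑ᵛ-cong K λ y′ → trans
         (cong (_*ᶻ f (x′ , y′)) (ind-⊠ (G._≟_ x x′) (K._~?_ y y′) (G._~?_ x x′) (K._≟_ y y′) G.~-irrefl K.~-irrefl))
         (expand (ind (G._≟_ x x′)) (ind (K._~?_ y y′)) (ind (G._~?_ x x′)) (ind (K._≟_ y y′)) (f (x′ , y′))))
         (inner x′)) ⟩
  (∑ᵛ G λ x′ → ind (G._≟_ x x′) *ᶻ ∑~ K y (λ y′ → f (x′ , y′)) +ᶻ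
    (ind (G._~?_ x x′) *ᶻ f (x′ , y) +ᶻ ind (G._~?_ x x′) *ᶻ ∑~ K y (λ y′ → f (x′ , y′))))
    ≡⟨ split G.order _ _ _ ⟩
  (∑ᵛ G λ x′ → ind (G._≟_ x x′) *ᶻ ∑~ K y (λ y′ → f (x′ , y′))) +ᶻ
    (∑~ G x (λ x′ → f (x′ , y)) +ᶻ ∑~ G x (λ x′ → ∑~ K y λ y′ → f (x′ , y′)))
    ≡⟨ cong (_+ᶻ (∑~ G x (λ x′ → f (x′ , y)) +ᶻ ∑~ G x (λ x′ → ∑~ K y λ y′ → f (x′ , y′)))) (∑ᵛ-select G x (λ x′ → ∑~ K y λ y′ → f (x′ , y′))) ⟩
  ∑~ K y (λ y′ → f (x , y′)) +ᶻ (∑~ G x (λ x′ → f (x′ , y)) +ᶻ ∑~ G x (λ x′ → ∑~ K y λ y′ → f (x′ , y′))) ∎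
  where
  open ≡-Reasoning
  module G = Graph G
  module K = Graph K
  expand : ∀ p q r s w → (p *ᶻ q +ᶻ (r *ᶻ s +ᶻ r *ᶻ q)) *ᶻ w ≡ p *ᶻ (q *ᶻ w) +ᶻ (r *ᶻ (s *ᶻ w) +ᶻ r *ᶻ (q *ᶻ w))
  expand = solve-∀
  split : ∀ n (f g h : Fin n → ℤ) → sum (λ i → f i +ᶻ (g i +ᶻ h i)) ≡ sum f +ᶻ (sum g +ᶻ sum h)
  split n f g h = trans (∑-distrib-+ f (λ i → g i +ᶻ h i)) (cong (sum f +ᶻ_) (∑-distrib-+ g h))
  inner : ∀ x′ → (∑ᵛ K λ y′ → ind (G._≟_ x x′) *ᶻ (ind (K._~?_ y y′) *ᶻ f (x′ , y′)) +ᶻ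
            (ind (G._~?_ x x′) *ᶻ (ind (K._≟_ y y′) *ᶻ f (x′ , y′)) +ᶻ ind (G._~?_ x x′) *ᶻ (ind (K._~?_ y y′) *ᶻ f (x′ , y′)))) ≡
          ind (G._≟_ x x′) *ᶻ ∑~ K y (λ y′ → f (x′ , y′)) +ᶻ
            (ind (G._~?_ x x′) *ᶻ f (x′ , y) +ᶻ ind (G._~?_ x x′) *ᶻ ∑~ K y (λ y′ → f (x′ , y′)))
  inner x′ = trans (split K.order _ _ _) (cong₂ _+ᶻ_ (sym (*-distribˡ-sum {K.order} (ind (G._≟_ x x′)) _))
    (cong₂ _+ᶻ_ (trans (sym (*-distribˡ-sum {K.order} (ind (G._~?_ x x′)) _)) (cong (ind (G._~?_ x x′) *ᶻ_) (∑ᵛ-select K y (λ y′ → f (x′ , y′)))))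
                (sym (*-distribˡ-sum {K.order} (ind (G._~?_ x x′)) _))))

-- The neighbour sum within one pair of copies: neighbours with the same first coordinate, with the
-- same second coordinate, and differing in both. The first term is independent of t, the second of
-- s, the third of both.
weight : ∀ {m n p q} → (Fin p → Fin m → Fin q → Fin n → ℤ) → Fin p → Fin m → Fin q → Fin n → ℤ
weight u i s j t =
  (∑≠ j λ j′ → sum λ t′ → u i s j′ t′) +ᶻ
  ((∑≠ i λ i′ → sum λ s′ → u i′ s′ j t) +ᶻ
   (∑≠ i λ i′ → sum λ s′ → ∑≠ j λ j′ → sum λ t′ → u i′ s′ j′ t′))

∑~-product : ∀ a b m n p q α i s β j t f →
  ∑~ (a · H m p ⊠ b · H n q) ((α , i , s) , (β , j , t)) f ≡
  weight (λ i s j t → f ((α , i , s) , (β , j , t))) i s j t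
∑~-product a b m n p q α i s β j t f = trans (∑~-⊠ (a · H m p) (b · H n q) _ _ f)
  (cong₂ _+ᶻ_ (∑~-·H b n q β j t λ y → f ((α , i , s) , y))
    (cong₂ _+ᶻ_ (∑~-·H a m p α i s λ x → f (x , (β , j , t)))
      (trans (∑~-·H a m p α i s λ x → ∑~ (b · H n q) (β , j , t) λ y → f (x , y))
             (∑≠-cong i λ i′ → sum-cong-≗ λ s′ → ∑~-·H b n q β j t λ y → f ((α , i′ , s′) , y)))))

-- From magic rectangles to distance magic labellings

injective⇒surjective : ∀ {n} {f : Fin n → Fin n} → (∀ {i j} → f i ≡ f j → i ≡ j) → ∀ y → ∃ λ x → f x ≡ y
injective⇒surjective {suc n} {f} f-injective y with any? (λ x → f x ≟ y)
... | yes hit  = hit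
... | no  ¬hit = ⊥-elim (ℕ.1+n≰n (injective⇒≤ {f = λ x → punchOut (y≢f x)}
                   λ {i} {j} eq → f-injective (punchOut-injective (y≢f i) (y≢f j) eq)))
  where
  y≢f : ∀ x → y ≢ f x
  y≢f x y≡fx = ¬hit (x , sym y≡fx)

injective⇒bijection : ∀ {V : Set} {n} → V ↔ Fin n → (g : Fin n → V) → (∀ {i j} → g i ≡ g j → i ≡ j) →
                      ∃ λ (f : V ⤖ Fin n) → ∀ x → g (Bijection.to f x) ≡ x
injective⇒bijection V↔Fin g g-injective =
  mk⤖ {to = label} ((λ {x} {y} eq → trans (sym (g∘label x)) (trans (cong g eq) (g∘label y)))
      , λ v → g v , λ { refl → g-injective (g∘label (g v)) }) , g∘label
  where
  open Inverse V↔Fin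
  to-injective : ∀ {x y} → to x ≡ to y → x ≡ y
  to-injective {x} {y} eq = trans (sym (strictlyInverseʳ x)) (trans (cong from eq) (strictlyInverseʳ y))
  preimage : ∀ k → ∃ λ v → to (g v) ≡ k
  preimage = injective⇒surjective (g-injective ∘ to-injective)
  label : _ → _
  label x = proj₁ (preimage (to x))
  g∘label : ∀ x → g (label x) ≡ x
  g∘label x = to-injective (proj₂ (preimage (to x)))

sum-double : ∀ {n} c (w e : Fin n → ℤ) → (∀ t → + 2 *ᶻ w t ≡ e t +ᶻ c) → sum e ≡ + 0 → + 2 *ᶻ sum w ≡ + n *ᶻ c
sum-double {n} c w e 2w≡ ∑e≡0 = begin
  + 2 *ᶻ sum w                  ≡⟨ *-distribˡ-sum (+ 2) w ⟩
  sum (λ t → + 2 *ᶻ w t)        ≡⟨ sum-cong-≗ 2w≡ ⟩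
  sum (λ t → e t +ᶻ c)          ≡⟨ ∑-distrib-+ e (λ _ → c) ⟩
  sum e +ᶻ sum {n} (λ _ → c)    ≡⟨ cong₂ _+ᶻ_ ∑e≡0 (sum-const n c) ⟩
  + 0 +ᶻ + n *ᶻ c               ≡⟨ ℤ.+-identityˡ _ ⟩
  + n *ᶻ c                      ∎
  where open ≡-Reasoning

-ᶻ-cancelʳ : ∀ x y z → x -ᶻ z ≡ y -ᶻ z → x ≡ y
-ᶻ-cancelʳ x y z eq = trans (restore x z) (trans (cong (_+ᶻ z) eq) (sym (restore y z)))
  where
  restore : ∀ x z → x ≡ x -ᶻ z +ᶻ z
  restore = solve-∀

weight-const : ∀ {m n p q} (u : Fin p → Fin m → Fin q → Fin n → ℤ) {R C} →
               (∀ i s j → sum (λ t → u i s j t) ≡ R) → (∀ i j t → sum (λ s → u i s j t) ≡ C) →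
               ∀ i s j t → weight u i s j t ≡ (sum {q} (λ _ → R) -ᶻ R) +ᶻ
                 ((sum {p} (λ _ → C) -ᶻ C) +ᶻ
                  (sum {p} (λ _ → sum {m} λ _ → sum {q} (λ _ → R) -ᶻ R) -ᶻ sum {m} λ _ → sum {q} (λ _ → R) -ᶻ R))
weight-const u rows cols i s j t =
  cong₂ _+ᶻ_ (∑≠-cong j λ j′ → rows i s j′)
    (cong₂ _+ᶻ_ (∑≠-cong i λ i′ → cols i′ j t)
                (∑≠-cong i λ i′ → sum-cong-≗ λ s′ → ∑≠-cong j λ j′ → rows i′ s′ j′))

module _ (a b m n p q : ℕ) (A : MagicSet (a * p * (b * q)) m n) where

  private
    G = a · H m p ⊠ b · H n q
    N = a * p * (b * q) * (m * n)
    module A = MagicSet A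

    value : Vertex G → ℤ
    value ((α , i , s) , (β , j , t)) = A.entry (combine (combine α i) (combine β j)) s t

    order≡N : order G ≡ N
    order≡N = ring a b m n p q
      where
      ring : ∀ a b m n p q → a * (p * m) * (b * (q * n)) ≡ a * p * (b * q) * (m * n)
      ring = solve-∀ᴺ

    locate : ∀ {w} → (∃ λ γ → ∃₂ λ s t → A.entry γ s t ≡ w) → ∃ λ x → value x ≡ w
    locate (γ , s , t , eq) = ((α , i , s) , (β , j , t)) , trans (cong (λ g → A.entry g s t) recombine) eq
      where
      αi = proj₁ (remQuot {a * p} (b * q) γ)
      βj = proj₂ (remQuot {a * p} (b * q) γ)
      α = proj₁ (remQuot {a} p αi)
      i = proj₂ (remQuot {a} p αi)
      β = proj₁ (remQuot {b} q βj)
      j = proj₂ (remQuot {b} q βj)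
      recombine : combine (combine α i) (combine β j) ≡ γ
      recombine = trans (cong₂ combine (combine-remQuot {a} p αi) (combine-remQuot {b} q βj))
                        (combine-remQuot {a * p} (b * q) γ)

    -- Choosing a vertex for each value is injective, hence bijective by counting; the labelling
    -- will be the inverse. This recovers the distinctness of the entries.
    hit : ∀ (v : Fin (order G)) → ∃ λ x → value x ≡ + (1 + toℕ v * 2) -ᶻ + N
    hit v = locate (A.attains (subst (toℕ v <_) order≡N (toℕ<n v)))

    hit-injective : ∀ {u v} → proj₁ (hit u) ≡ proj₁ (hit v) → u ≡ v
    hit-injective {u} {v} eq = toℕ-injective (ℕ.*-cancelʳ-≡ (toℕ u) (toℕ v) 2 (ℕ.suc-injective (ℤ.+-injective
      (-ᶻ-cancelʳ (+ (1 + toℕ u * 2)) (+ (1 + toℕ v * 2)) (+ N)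
        (trans (sym (proj₂ (hit u))) (trans (cong value eq) (proj₂ (hit v))))))))

  -- Since 2 · label = value + (N + 1), doubled row sums are n(N + 1) and doubled column sums m(N +
  -- 1) in every block. The reference vertex x₀ names the common sums without a division.
  labelling : Vertex G → (f : Vertex G ⤖ Fin (order G)) →
              (∀ x → value x ≡ + (1 + toℕ (Bijection.to f x) * 2) -ᶻ + N) → DistanceMagic G
  labelling x₀@((α₀ , i₀ , s₀) , (β₀ , j₀ , t₀)) f value-label =
    f , k x₀ , λ x → ℤ.+-injective (trans (constant x) (sym (constant x₀)))
    where
    label : Vertex G → ℕ
    label x = suc (toℕ (Bijection.to f x))
    k : Vertex G → ℕ
    k x = List.sum (map label (neighbours G x))
    doubled : ∀ x → + 2 *ᶻ + label x ≡ value x +ᶻ (+ N +ᶻ + 1)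
    doubled x = begin
      + 2 *ᶻ + suc l                               ≡⟨ ring (+ l) (+ N) ⟩
      (+ 1 +ᶻ + l *ᶻ + 2 -ᶻ + N) +ᶻ (+ N +ᶻ + 1)   ≡⟨ cong (λ z → (+ 1 +ᶻ z -ᶻ + N) +ᶻ (+ N +ᶻ + 1)) (ℤ.pos-* l 2) ⟨
      (+ (1 + l * 2) -ᶻ + N) +ᶻ (+ N +ᶻ + 1)       ≡⟨ cong (_+ᶻ (+ N +ᶻ + 1)) (value-label x) ⟨
      value x +ᶻ (+ N +ᶻ + 1)                      ∎
      where
      open ≡-Reasoning
      l = toℕ (Bijection.to f x)
      ring : ∀ l N → + 2 *ᶻ (+ 1 +ᶻ l) ≡ (+ 1 +ᶻ l *ᶻ + 2 -ᶻ N) +ᶻ (N +ᶻ + 1)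
      ring = solve-∀
    R C W : ℤ
    R = sum λ t → + label ((α₀ , i₀ , s₀) , (β₀ , j₀ , t))
    C = sum λ s → + label ((α₀ , i₀ , s) , (β₀ , j₀ , t₀))
    W = (sum {q} (λ _ → R) -ᶻ R) +ᶻ ((sum {p} (λ _ → C) -ᶻ C) +ᶻ
        (sum {p} (λ _ → sum {m} λ _ → sum {q} (λ _ → R) -ᶻ R) -ᶻ sum {m} λ _ → sum {q} (λ _ → R) -ᶻ R))
    2*row : ∀ α i s β j → + 2 *ᶻ sum (λ t → + label ((α , i , s) , (β , j , t))) ≡ + n *ᶻ (+ N +ᶻ + 1)
    2*row α i s β j = sum-double (+ N +ᶻ + 1) _ (λ t → value ((α , i , s) , (β , j , t)))
      (λ t → doubled ((α , i , s) , (β , j , t))) (A.row-sum (combine (combine α i) (combine β j)) s)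
    2*col : ∀ α i β j t → + 2 *ᶻ sum (λ s → + label ((α , i , s) , (β , j , t))) ≡ + m *ᶻ (+ N +ᶻ + 1)
    2*col α i β j t = sum-double (+ N +ᶻ + 1) _ (λ s → value ((α , i , s) , (β , j , t)))
      (λ s → doubled ((α , i , s) , (β , j , t))) (A.col-sum (combine (combine α i) (combine β j)) t)
    constant : ∀ x → + k x ≡ W
    constant x@((α , i , s) , (β , j , t)) = trans (neighbour-sum G label x)
      (trans (∑~-product a b m n p q α i s β j t (+_ ∘ label))
        (weight-const (λ i s j t → + label ((α , i , s) , (β , j , t))) {R} {C}
          (λ i s j → ℤ.*-cancelˡ-≡ (+ 2) _ _ (trans (2*row α i s β j) (sym (2*row α₀ i₀ s₀ β₀ j₀))))
          (λ i j t → ℤ.*-cancelˡ-≡ (+ 2) _ _ (trans (2*col α i β j t) (sym (2*col α₀ i₀ β₀ j₀ t₀))))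
          i s j t))

  magicSet⇒distanceMagic : Vertex G → DistanceMagic G
  magicSet⇒distanceMagic x₀ = let f , hit∘f = injective⇒bijection (finite G) (proj₁ ∘ hit) hit-injective in
    labelling x₀ f λ x → trans (cong value (sym (hit∘f x))) (proj₂ (hit (Bijection.to f x)))

-- Necessity

*-∑≠ : ∀ {n} c (i : Fin n) (f : Fin n → ℤ) → c *ᶻ ∑≠ i f ≡ ∑≠ i (λ k → c *ᶻ f k)
*-∑≠ c i f = trans (distrib c (sum f) (f i)) (cong (_-ᶻ c *ᶻ f i) (*-distribˡ-sum c f))
  where
  distrib : ∀ c x y → c *ᶻ (x -ᶻ y) ≡ c *ᶻ x -ᶻ c *ᶻ y
  distrib = solve-∀

sum-− : ∀ {n} (f g : Fin n → ℤ) → sum (λ i → f i -ᶻ g i) ≡ sum f -ᶻ sum g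
sum-− f g = trans (∑-distrib-+ f (λ i → -ᶻ g i)) (cong (sum f +ᶻ_) (sum-neg g))

sum-∑≠ : ∀ {m n} (j : Fin n) (f : Fin m → Fin n → ℤ) → sum (λ s → ∑≠ j (f s)) ≡ ∑≠ j (λ j′ → sum λ s → f s j′)
sum-∑≠ j f = trans (sum-− (λ s → sum (f s)) (λ s → f s j)) (cong (_-ᶻ sum (λ s → f s j)) (∑-comm f))

cancel-nonZero : ∀ c {x} → + suc c *ᶻ x ≡ + 0 → x ≡ + 0
cancel-nonZero c {x} eq with ℤ.i*j≡0⇒i≡0∨j≡0 (+ suc c) {x} eq
... | inj₂ x≡0 = x≡0

-- Adding up all equations gives n - 1 times the total on both sides, so the totals agree, and then
-- so do the single terms.
∑≠-injective : ∀ {n} → 1 < n → {f g : Fin n → ℤ} → (∀ i → ∑≠ i f ≡ ∑≠ i g) → ∀ i → f i ≡ g i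
∑≠-injective {suc zero} (s≤s ())
∑≠-injective {suc (suc n)} _ {f} {g} eq i = begin
  f i                  ≡⟨ restore (sum f) (f i) ⟩
  sum f -ᶻ ∑≠ i f      ≡⟨ cong₂ _-ᶻ_ totals (eq i) ⟩
  sum g -ᶻ ∑≠ i g      ≡⟨ restore (sum g) (g i) ⟨
  g i                  ∎
  where
  open ≡-Reasoning
  restore : ∀ s x → x ≡ s -ᶻ (s -ᶻ x)
  restore = solve-∀
  ring : ∀ n s → (+ 2 +ᶻ n) *ᶻ s -ᶻ s ≡ (+ 1 +ᶻ n) *ᶻ s
  ring = solve-∀
  total : ∀ (h : Fin (suc (suc n)) → ℤ) → sum (λ i → ∑≠ i h) ≡ + suc n *ᶻ sum h
  total h = trans (sum-− (λ _ → sum h) h)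
    (trans (cong (_-ᶻ sum h) (sum-const (suc (suc n)) (sum h))) (ring (+ n) (sum h)))
  totals : sum f ≡ sum g
  totals = ℤ.*-cancelˡ-≡ (+ suc n) (sum f) (sum g)
    (trans (sym (total f)) (trans (sum-cong-≗ eq) (total g)))

-- With g = mn - n, two rows of S differ by d_j in column j and by δ = Σ_j d_j in total, where
-- (g - m) d_j = g δ; summing over j forces δ = 0.
rows-equal : ∀ m n D {p q} (S : Fin p → Fin (suc q) → ℤ) (c : Fin (suc q) → ℤ) T K →
  + suc m *ᶻ + n -ᶻ + n -ᶻ + suc m ≡ + suc D →
  (∀ i j → + n *ᶻ (sum (S i) -ᶻ S i j) +ᶻ (+ suc m *ᶻ (c j -ᶻ S i j) +ᶻ
    + suc m *ᶻ + n *ᶻ ((T -ᶻ c j) -ᶻ (sum (S i) -ᶻ S i j))) ≡ K) →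
  ∀ i i′ j → S i j ≡ S i′ j
rows-equal m n D {q = q} S c T K D≡ eq i i′ j =
  ℤ.i-j≡0⇒i≡j (S i j) (S i′ j) (cancel-nonZero D (trans (difference j) (trans (cong (g *ᶻ_) δ≡0) (ℤ.*-zeroʳ g))))
  where
  open ≡-Reasoning
  lhs : ∀ i j → ℤ
  lhs i j = + n *ᶻ (sum (S i) -ᶻ S i j) +ᶻ (+ suc m *ᶻ (c j -ᶻ S i j) +ᶻ
    + suc m *ᶻ + n *ᶻ ((T -ᶻ c j) -ᶻ (sum (S i) -ᶻ S i j)))
  g δ : ℤ
  g = + m *ᶻ + n
  δ = sum (S i) -ᶻ sum (S i′)
  rearrange : ∀ m n r S r′ S′ c T → ((+ 1 +ᶻ m) *ᶻ n -ᶻ n -ᶻ (+ 1 +ᶻ m)) *ᶻ (S -ᶻ S′) ≡ m *ᶻ n *ᶻ (r -ᶻ r′) +ᶻ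
    ((n *ᶻ (r -ᶻ S) +ᶻ ((+ 1 +ᶻ m) *ᶻ (c -ᶻ S) +ᶻ (+ 1 +ᶻ m) *ᶻ n *ᶻ ((T -ᶻ c) -ᶻ (r -ᶻ S)))) -ᶻ
     (n *ᶻ (r′ -ᶻ S′) +ᶻ ((+ 1 +ᶻ m) *ᶻ (c -ᶻ S′) +ᶻ (+ 1 +ᶻ m) *ᶻ n *ᶻ ((T -ᶻ c) -ᶻ (r′ -ᶻ S′)))))
  rearrange = solve-∀
  vanish : ∀ x K → x +ᶻ (K -ᶻ K) ≡ x
  vanish = solve-∀
  difference : ∀ j → + suc D *ᶻ (S i j -ᶻ S i′ j) ≡ g *ᶻ δ
  difference j = begin
    + suc D *ᶻ (S i j -ᶻ S i′ j)
      ≡⟨ cong (_*ᶻ (S i j -ᶻ S i′ j)) D≡ ⟨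
    (+ suc m *ᶻ + n -ᶻ + n -ᶻ + suc m) *ᶻ (S i j -ᶻ S i′ j)
      ≡⟨ rearrange (+ m) (+ n) (sum (S i)) (S i j) (sum (S i′)) (S i′ j) (c j) T ⟩
    g *ᶻ δ +ᶻ (lhs i j -ᶻ lhs i′ j)
      ≡⟨ cong₂ (λ x y → g *ᶻ δ +ᶻ (x -ᶻ y)) (eq i j) (eq i′ j) ⟩
    g *ᶻ δ +ᶻ (K -ᶻ K)
      ≡⟨ vanish (g *ᶻ δ) K ⟩
    g *ᶻ δ ∎
  summed : + suc D *ᶻ δ ≡ + suc q *ᶻ (g *ᶻ δ)
  summed = begin
    + suc D *ᶻ δ                                    ≡⟨ cong (+ suc D *ᶻ_) (sum-− (S i) (S i′)) ⟨
    + suc D *ᶻ sum (λ j → S i j -ᶻ S i′ j)          ≡⟨ *-distribˡ-sum (+ suc D) (λ j → S i j -ᶻ S i′ j) ⟩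
    sum (λ j → + suc D *ᶻ (S i j -ᶻ S i′ j))        ≡⟨ sum-cong-≗ difference ⟩
    sum {suc q} (λ _ → g *ᶻ δ)                      ≡⟨ sum-const (suc q) (g *ᶻ δ) ⟩
    + suc q *ᶻ (g *ᶻ δ)                             ∎
  collect : ∀ q m n δ → (+ 1 +ᶻ (m +ᶻ q *ᶻ (m *ᶻ n))) *ᶻ δ ≡
            (+ 1 +ᶻ q) *ᶻ (m *ᶻ n *ᶻ δ) -ᶻ ((+ 1 +ᶻ m) *ᶻ n -ᶻ n -ᶻ (+ 1 +ᶻ m)) *ᶻ δ
  collect = solve-∀
  δ≡0 : δ ≡ + 0
  -- The coefficient left for δ is (q + 1)mn - (mn - m - 1) = 1 + m + qmn, which is positive.
  δ≡0 = cancel-nonZero (m + q * (m * n)) (begin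
    + suc (m + q * (m * n)) *ᶻ δ
      ≡⟨ cong (λ z → (+ 1 +ᶻ (+ m +ᶻ z)) *ᶻ δ) (trans (ℤ.pos-* q (m * n)) (cong (+ q *ᶻ_) (ℤ.pos-* m n))) ⟩
    (+ 1 +ᶻ (+ m +ᶻ + q *ᶻ g)) *ᶻ δ
      ≡⟨ collect (+ q) (+ m) (+ n) δ ⟩
    + suc q *ᶻ (g *ᶻ δ) -ᶻ (+ suc m *ᶻ + n -ᶻ + n -ᶻ + suc m) *ᶻ δ
      ≡⟨ cong₂ (λ x y → x -ᶻ y *ᶻ δ) (sym summed) D≡ ⟩
    + suc D *ᶻ δ -ᶻ + suc D *ᶻ δ
      ≡⟨ ℤ.+-inverseʳ (+ suc D *ᶻ δ) ⟩
    + 0 ∎)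

module BlockSums {m n p q D : ℕ} (1<p : 1 < suc p) (1<q : 1 < suc q)
  (D≡ : + suc m *ᶻ + suc n -ᶻ + suc n -ᶻ + suc m ≡ + suc D)
  (u : Fin (suc p) → Fin (suc m) → Fin (suc q) → Fin (suc n) → ℤ) (K : ℤ)
  (magic : ∀ i s j t → weight u i s j t ≡ K) where

  open ≡-Reasoning

  row : Fin (suc p) → Fin (suc m) → Fin (suc q) → ℤ
  row i s j = sum λ t → u i s j t

  col : Fin (suc p) → Fin (suc q) → Fin (suc n) → ℤ
  col i j t = sum λ s → u i s j t

  S : Fin (suc p) → Fin (suc q) → ℤ
  S i j = sum λ s → row i s j

  private
    cancel-middle : ∀ X {Y Y′} Z → X +ᶻ (Y +ᶻ Z) ≡ X +ᶻ (Y′ +ᶻ Z) → Y ≡ Y′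
    cancel-middle X {Y} {Y′} Z eq = trans (extract X Y Z) (trans (cong (_-ᶻ (X +ᶻ Z)) eq) (sym (extract X Y′ Z)))
      where
      extract : ∀ X Y Z → Y ≡ X +ᶻ (Y +ᶻ Z) -ᶻ (X +ᶻ Z)
      extract = solve-∀

  -- A change of t affects only the middle term of `weight`. Its equality for every i is an equality
  -- of sums with one term left out; `row-const` uses the first term in the same way.
  col-const : ∀ i j t t′ → col i j t ≡ col i j t′
  col-const i j t t′ = ∑≠-injective 1<p {λ i → col i j t} {λ i → col i j t′}
    (λ i → cancel-middle (∑≠ j (row i zero)) (∑≠ i λ i′ → sum λ s′ → ∑≠ j (row i′ s′))
             (trans (magic i zero j t) (sym (magic i zero j t′)))) i

  row-const : ∀ i j s s′ → row i s j ≡ row i s′ j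
  row-const i j s s′ = ∑≠-injective 1<q {row i s} {row i s′}
    (λ j → -ᶻ-cancelʳ _ _ (-ᶻ rest j) (trans (double-neg (∑≠ j (row i s)) (rest j))
             (trans (trans (magic i s j zero) (sym (magic i s′ j zero))) (sym (double-neg (∑≠ j (row i s′)) (rest j)))))) j
    where
    rest : Fin (suc q) → ℤ
    rest j = (∑≠ i λ i′ → col i′ j zero) +ᶻ (∑≠ i λ i′ → sum λ s′ → ∑≠ j (row i′ s′))
    double-neg : ∀ x y → x -ᶻ (-ᶻ y) ≡ x +ᶻ y
    double-neg = solve-∀

  S≡m*row : ∀ i s j → S i j ≡ + suc m *ᶻ row i s j
  S≡m*row i s j = trans (sum-cong-≗ λ s′ → row-const i j s′ s) (sum-const (suc m) (row i s j))

  S≡n*col : ∀ i j t → S i j ≡ + suc n *ᶻ col i j t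
  S≡n*col i j t = trans (∑-comm λ s t → u i s j t)
    (trans (sum-cong-≗ λ t′ → col-const i j t′ t) (sum-const (suc n) (col i j t)))

  private
    M N : ℤ
    M = + suc m
    N = + suc n
    r : Fin (suc p) → ℤ
    r i = sum (S i)
    c : Fin (suc q) → ℤ
    c j = sum λ i → S i j
    T : ℤ
    T = sum r

  -- Multiplying the weight by MN turns row and column sums into block sums, so a system in `S`
  -- alone remains.
  system : ∀ i j → N *ᶻ (r i -ᶻ S i j) +ᶻ (M *ᶻ (c j -ᶻ S i j) +ᶻ M *ᶻ N *ᶻ ((T -ᶻ c j) -ᶻ (r i -ᶻ S i j))) ≡ M *ᶻ N *ᶻ K
  system i j = begin
    N *ᶻ ∑≠ j (S i) +ᶻ (M *ᶻ ∑≠ i (λ i′ → S i′ j) +ᶻ M *ᶻ N *ᶻ ((T -ᶻ c j) -ᶻ ∑≠ j (S i)))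
      ≡⟨ cong₂ _+ᶻ_ (cong (N *ᶻ_) (sym (trans (*-∑≠ M j (row i zero)) (∑≠-cong j λ j′ → sym (S≡m*row i zero j′)))))
           (cong₂ _+ᶻ_ (cong (M *ᶻ_) (sym (trans (*-∑≠ N i (λ i′ → col i′ j zero)) (∑≠-cong i λ i′ → sym (S≡n*col i′ j zero)))))
             (cong (M *ᶻ N *ᶻ_) (sym (trans (∑≠-cong i λ i′ → sum-∑≠ j (row i′)) (cong (_-ᶻ ∑≠ j (S i)) (sum-− r (λ i′ → S i′ j))))))) ⟩
    N *ᶻ (M *ᶻ X) +ᶻ (M *ᶻ (N *ᶻ Y) +ᶻ M *ᶻ N *ᶻ Z)
      ≡⟨ ring M N X Y Z ⟩
    M *ᶻ N *ᶻ weight u i zero j zero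
      ≡⟨ cong (M *ᶻ N *ᶻ_) (magic i zero j zero) ⟩
    M *ᶻ N *ᶻ K ∎
    where
    X Y Z : ℤ
    X = ∑≠ j (row i zero)
    Y = ∑≠ i λ i′ → col i′ j zero
    Z = ∑≠ i λ i′ → sum λ s′ → ∑≠ j (row i′ s′)
    ring : ∀ M N X Y Z → N *ᶻ (M *ᶻ X) +ᶻ (M *ᶻ (N *ᶻ Y) +ᶻ M *ᶻ N *ᶻ Z) ≡ M *ᶻ N *ᶻ (X +ᶻ (Y +ᶻ Z))
    ring = solve-∀

  S-const : ∀ i j i′ j′ → S i j ≡ S i′ j′
  S-const i j i′ j′ = trans (rows-equal m (suc n) D S c T (M *ᶻ N *ᶻ K) D≡ system i i′ j)
    (rows-equal n (suc m) D (λ j i → S i j) r T (M *ᶻ N *ᶻ K) (trans (swap M N) D≡)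
      (λ j i → trans (swap′ M N (c j) (S i j) (r i) T) (system i j)) j j′ i′)
    where
    swap : ∀ M N → N *ᶻ M -ᶻ M -ᶻ N ≡ M *ᶻ N -ᶻ N -ᶻ M
    swap = solve-∀
    swap′ : ∀ M N c S r T → M *ᶻ (c -ᶻ S) +ᶻ (N *ᶻ (r -ᶻ S) +ᶻ N *ᶻ M *ᶻ ((T -ᶻ r) -ᶻ (c -ᶻ S))) ≡
            N *ᶻ (r -ᶻ S) +ᶻ (M *ᶻ (c -ᶻ S) +ᶻ M *ᶻ N *ᶻ ((T -ᶻ c) -ᶻ (r -ᶻ S)))
    swap′ = solve-∀

  -- The coefficient depends only on the sizes. This lets block sums be compared between different
  -- pairs of copies, which share only the magic constant.
  S-determined : ∀ i j → (+ suc n *ᶻ + q +ᶻ (+ suc m *ᶻ + p +ᶻ + suc m *ᶻ + suc n *ᶻ (+ p *ᶻ + q))) *ᶻ S i j ≡ + suc m *ᶻ + suc n *ᶻ K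
  S-determined i j = begin
    (N *ᶻ + q +ᶻ (M *ᶻ + p +ᶻ M *ᶻ N *ᶻ (+ p *ᶻ + q))) *ᶻ σ
      ≡⟨ ring M N (+ p) (+ q) σ ⟩
    N *ᶻ (+ suc q *ᶻ σ -ᶻ σ) +ᶻ (M *ᶻ (+ suc p *ᶻ σ -ᶻ σ) +ᶻ
      M *ᶻ N *ᶻ ((+ suc p *ᶻ (+ suc q *ᶻ σ) -ᶻ + suc p *ᶻ σ) -ᶻ (+ suc q *ᶻ σ -ᶻ σ)))
      ≡⟨ cong₂ (λ x y → N *ᶻ (x -ᶻ σ) +ᶻ (M *ᶻ (y -ᶻ σ) +ᶻ M *ᶻ N *ᶻ ((+ suc p *ᶻ x -ᶻ y) -ᶻ (x -ᶻ σ)))) (sym (r≡ i)) (sym c≡) ⟩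
    N *ᶻ (r i -ᶻ σ) +ᶻ (M *ᶻ (c j -ᶻ σ) +ᶻ M *ᶻ N *ᶻ ((+ suc p *ᶻ r i -ᶻ c j) -ᶻ (r i -ᶻ σ)))
      ≡⟨ cong (λ t → N *ᶻ (r i -ᶻ σ) +ᶻ (M *ᶻ (c j -ᶻ σ) +ᶻ M *ᶻ N *ᶻ ((t -ᶻ c j) -ᶻ (r i -ᶻ σ)))) (sym T≡) ⟩
    N *ᶻ (r i -ᶻ σ) +ᶻ (M *ᶻ (c j -ᶻ σ) +ᶻ M *ᶻ N *ᶻ ((T -ᶻ c j) -ᶻ (r i -ᶻ σ)))
      ≡⟨ system i j ⟩
    M *ᶻ N *ᶻ K ∎
    where
    σ = S i j
    r≡ : ∀ i′ → r i′ ≡ + suc q *ᶻ σ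
    r≡ i′ = trans (sum-cong-≗ λ j′ → S-const i′ j′ i j) (sum-const (suc q) σ)
    c≡ : c j ≡ + suc p *ᶻ σ
    c≡ = trans (sum-cong-≗ λ i′ → S-const i′ j i j) (sum-const (suc p) σ)
    T≡ : T ≡ + suc p *ᶻ r i
    T≡ = trans (sum-cong-≗ λ i′ → trans (r≡ i′) (sym (r≡ i))) (sum-const (suc p) (r i))
    ring : ∀ M N p q σ → (N *ᶻ q +ᶻ (M *ᶻ p +ᶻ M *ᶻ N *ᶻ (p *ᶻ q))) *ᶻ σ ≡
      N *ᶻ ((+ 1 +ᶻ q) *ᶻ σ -ᶻ σ) +ᶻ (M *ᶻ ((+ 1 +ᶻ p) *ᶻ σ -ᶻ σ) +ᶻ
        M *ᶻ N *ᶻ (((+ 1 +ᶻ p) *ᶻ ((+ 1 +ᶻ q) *ᶻ σ) -ᶻ (+ 1 +ᶻ p) *ᶻ σ) -ᶻ ((+ 1 +ᶻ q) *ᶻ σ -ᶻ σ)))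
    ring = solve-∀

-- The sum of all labels and the common line sums

triangle : ∀ n c → + 2 *ᶻ sum {n} (λ k → + (c + toℕ k)) ≡ + n *ᶻ (+ 2 *ᶻ + c +ᶻ + n -ᶻ + 1)
triangle zero    c = refl
triangle (suc n) c = begin
  + 2 *ᶻ (+ (c + 0) +ᶻ sum {n} (λ k → + (c + suc (toℕ k))))
    ≡⟨ cong₂ (λ x y → + 2 *ᶻ (+ x +ᶻ y)) (ℕ.+-identityʳ c) (sum-cong-≗ {n} λ k → cong +_ (ℕ.+-suc c (toℕ k))) ⟩
  + 2 *ᶻ (+ c +ᶻ sum {n} (λ k → + (suc c + toℕ k)))
    ≡⟨ ℤ.*-distribˡ-+ (+ 2) (+ c) _ ⟩
  + 2 *ᶻ + c +ᶻ + 2 *ᶻ sum {n} (λ k → + (suc c + toℕ k))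
    ≡⟨ cong (+ 2 *ᶻ + c +ᶻ_) (triangle n (suc c)) ⟩
  + 2 *ᶻ + c +ᶻ + n *ᶻ (+ 2 *ᶻ + suc c +ᶻ + n -ᶻ + 1)
    ≡⟨ ring (+ c) (+ n) ⟩
  + suc n *ᶻ (+ 2 *ᶻ + c +ᶻ + suc n -ᶻ + 1) ∎
  where
  open ≡-Reasoning
  ring : ∀ c n → + 2 *ᶻ c +ᶻ n *ᶻ (+ 2 *ᶻ (+ 1 +ᶻ c) +ᶻ n -ᶻ + 1) ≡ (+ 1 +ᶻ n) *ᶻ (+ 2 *ᶻ c +ᶻ (+ 1 +ᶻ n) -ᶻ + 1)
  ring = solve-∀

label-total : ∀ G (f : Vertex G ⤖ Fin (order G)) →
              + 2 *ᶻ ∑ᵛ G (λ x → + suc (toℕ (Bijection.to f x))) ≡ + order G *ᶻ (+ order G +ᶻ + 1)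
label-total G f = begin
  + 2 *ᶻ ∑ᵛ G (λ x → + suc (toℕ (Bijection.to f x)))
    ≡⟨ cong (+ 2 *ᶻ_) (∑-permute (λ k → + suc (toℕ k)) (↔-trans (↔-sym (finite G)) (⤖⇒↔ f))) ⟨
  + 2 *ᶻ sum {order G} (λ k → + (1 + toℕ k))
    ≡⟨ triangle (order G) 1 ⟩
  + order G *ᶻ (+ 2 *ᶻ + 1 +ᶻ + order G -ᶻ + 1)
    ≡⟨ cong (+ order G *ᶻ_) (ring (+ order G)) ⟩
  + order G *ᶻ (+ order G +ᶻ + 1) ∎
  where
  open ≡-Reasoning
  ring : ∀ n → + 2 +ᶻ n -ᶻ + 1 ≡ n +ᶻ + 1
  ring = solve-∀

-- All block sums equal one σ, so the number of blocks times 2σ is N(N + 1). Writing σ as the number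
-- of lines in a block times a line sum and cancelling gives the line sum.
line-sums : ∀ {a b m n p q D} → + suc m *ᶻ + suc n -ᶻ + suc n -ᶻ + suc m ≡ + suc D →
  let G = suc a · H (suc m) (2 + p) ⊠ suc b · H (suc n) (2 + q) in DistanceMagic G →
  (∃ λ R → + 2 *ᶻ R ≡ + suc n *ᶻ (+ order G +ᶻ + 1)) × (∃ λ C → + 2 *ᶻ C ≡ + suc m *ᶻ (+ order G +ᶻ + 1))
line-sums {a} {b} {m} {n} {p} {q} {D} D≡ (f , k , magic) =
  (B.row zero zero zero zero zero , half-line m (suc n) (S≡m*row zero zero zero) (regroup-row A (+ P) B′ (+ Q) (+ suc m) (+ suc n))) ,
  (B.col zero zero zero zero zero , half-line n (suc m) (S≡n*col zero zero zero) (regroup-col A (+ P) B′ (+ Q) (+ suc m) (+ suc n)))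
  where
  open ≡-Reasoning
  P = 2 + p
  Q = 2 + q
  A B′ : ℤ
  A = + suc a
  B′ = + suc b
  G = suc a · H (suc m) P ⊠ suc b · H (suc n) Q
  w : Vertex G → ℤ
  w x = + suc (toℕ (Bijection.to f x))
  u : Fin (suc a) → Fin (suc b) → Fin P → Fin (suc m) → Fin Q → Fin (suc n) → ℤ
  u α β i s j t = w ((α , i , s) , (β , j , t))
  weight≡k : ∀ α β i s j t → weight (u α β) i s j t ≡ + k
  weight≡k α β i s j t = trans (sym (∑~-product (suc a) (suc b) (suc m) (suc n) P Q α i s β j t w))
    (trans (sym (neighbour-sum G (λ x → suc (toℕ (Bijection.to f x))) ((α , i , s) , (β , j , t))))
      (cong +_ (magic ((α , i , s) , (β , j , t)))))
  module B α β = BlockSums {m} {n} {suc p} {suc q} {D} (s≤s z<s) (s≤s z<s) D≡ (u α β) (+ k) (weight≡k α β)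
  open B zero zero using (S≡m*row; S≡n*col)
  σ : ℤ
  σ = B.S zero zero zero zero
  coefficient : ℕ
  coefficient = suc n * suc q + (suc m * suc p + suc m * suc n * (suc p * suc q))
  S≡σ : ∀ α β i j → B.S α β i j ≡ σ
  S≡σ α β i j = ℤ.*-cancelˡ-≡ (+ coefficient) _ _ (trans (B.S-determined α β i j) (sym (B.S-determined zero zero zero zero)))
  total : ∑ᵛ G w ≡ A *ᶻ (+ P *ᶻ (B′ *ᶻ (+ Q *ᶻ σ)))
  total = begin
    ∑ᵛ G w
      ≡⟨ trans (∑ᵛ-⊠ (suc a · H (suc m) P) (suc b · H (suc n) Q) w) (∑ᵛ-·H (suc a) (suc m) P λ x → ∑ᵛ (suc b · H (suc n) Q) λ y → w (x , y)) ⟩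
    (sum λ α → sum λ i → sum λ s → ∑ᵛ (suc b · H (suc n) Q) λ y → w ((α , i , s) , y))
      ≡⟨ (sum-cong-≗ λ α → sum-cong-≗ λ i → sum-cong-≗ λ s → ∑ᵛ-·H (suc b) (suc n) Q λ y → w ((α , i , s) , y)) ⟩
    (sum λ α → sum λ i → sum λ s → sum λ β → sum λ j → B.row α β i s j)
      ≡⟨ (sum-cong-≗ λ α → sum-cong-≗ λ i → trans (∑-comm λ s β → sum λ j → B.row α β i s j)
           (sum-cong-≗ λ β → trans (∑-comm λ s j → B.row α β i s j) (sum-cong-≗ λ j → S≡σ α β i j))) ⟩
    (sum {suc a} λ α → sum {P} λ i → sum {suc b} λ β → sum {Q} λ j → σ)
      ≡⟨ constants ⟩
    A *ᶻ (+ P *ᶻ (B′ *ᶻ (+ Q *ᶻ σ))) ∎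
    where
    constants : (sum {suc a} λ α → sum {P} λ i → sum {suc b} λ β → sum {Q} λ j → σ) ≡ A *ᶻ (+ P *ᶻ (B′ *ᶻ (+ Q *ᶻ σ)))
    constants = trans (sum-const (suc a) _) (cong (A *ᶻ_) (trans (sum-const P _) (cong (+ P *ᶻ_)
      (trans (sum-const (suc b) _) (cong (B′ *ᶻ_) (sum-const Q σ))))))
  regroup-row : ∀ A P B Q M N → A *ᶻ (P *ᶻ M) *ᶻ (B *ᶻ (Q *ᶻ N)) ≡ A *ᶻ (P *ᶻ (B *ᶻ (Q *ᶻ M))) *ᶻ N
  regroup-row = solve-∀
  regroup-col : ∀ A P B Q M N → A *ᶻ (P *ᶻ M) *ᶻ (B *ᶻ (Q *ᶻ N)) ≡ A *ᶻ (P *ᶻ (B *ᶻ (Q *ᶻ N))) *ᶻ M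
  regroup-col = solve-∀
  regroup : ∀ A P B Q x L → A *ᶻ (P *ᶻ (B *ᶻ (Q *ᶻ x))) *ᶻ (+ 2 *ᶻ L) ≡ + 2 *ᶻ (A *ᶻ (P *ᶻ (B *ᶻ (Q *ᶻ (x *ᶻ L)))))
  regroup = solve-∀
  half-line : ∀ x y {L} → σ ≡ + suc x *ᶻ L →
              A *ᶻ (+ P *ᶻ + suc m) *ᶻ (B′ *ᶻ (+ Q *ᶻ + suc n)) ≡ A *ᶻ (+ P *ᶻ (B′ *ᶻ (+ Q *ᶻ + suc x))) *ᶻ + y →
              + 2 *ᶻ L ≡ + y *ᶻ (+ order G +ᶻ + 1)
  half-line x y {L} σ≡ N≡ = ℤ.*-cancelˡ-≡ (A *ᶻ (+ P *ᶻ (B′ *ᶻ (+ Q *ᶻ + suc x)))) _ _ (begin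
    A *ᶻ (+ P *ᶻ (B′ *ᶻ (+ Q *ᶻ + suc x))) *ᶻ (+ 2 *ᶻ L)
      ≡⟨ regroup A (+ P) B′ (+ Q) (+ suc x) L ⟩
    + 2 *ᶻ (A *ᶻ (+ P *ᶻ (B′ *ᶻ (+ Q *ᶻ (+ suc x *ᶻ L)))))
      ≡⟨ cong (λ z → + 2 *ᶻ (A *ᶻ (+ P *ᶻ (B′ *ᶻ (+ Q *ᶻ z))))) σ≡ ⟨
    + 2 *ᶻ (A *ᶻ (+ P *ᶻ (B′ *ᶻ (+ Q *ᶻ σ))))
      ≡⟨ cong (+ 2 *ᶻ_) total ⟨
    + 2 *ᶻ ∑ᵛ G w
      ≡⟨ label-total G f ⟩
    + order G *ᶻ (+ order G +ᶻ + 1)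
      ≡⟨ cong (_*ᶻ (+ order G +ᶻ + 1)) N≡ ⟩
    A *ᶻ (+ P *ᶻ (B′ *ᶻ (+ Q *ᶻ + suc x))) *ᶻ + y *ᶻ (+ order G +ᶻ + 1)
      ≡⟨ ℤ.*-assoc (A *ᶻ (+ P *ᶻ (B′ *ᶻ (+ Q *ᶻ + suc x)))) (+ y) _ ⟩
    A *ᶻ (+ P *ᶻ (B′ *ᶻ (+ Q *ᶻ + suc x))) *ᶻ (+ y *ᶻ (+ order G +ᶻ + 1)) ∎)

-- Parity

even%2 : ∀ j → (j * 2) % 2 ≡ 0
even%2 j = m*n%n≡0 j 2

odd%2 : ∀ j → (1 + j * 2) % 2 ≡ 1
odd%2 j = [m+kn]%n≡m%n 1 j 2

odd≢even : ∀ i j → 1 + i * 2 ≢ j * 2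
odd≢even i j eq with trans (sym (odd%2 i)) (trans (cong (_% 2) eq) (even%2 j))
... | ()

halve-even : ∀ n → n % 2 ≡ 0 → ∃ λ j → n ≡ j * 2
halve-even n n%2≡0 with halve n
... | j , inj₁ n≡   = j , n≡
... | j , inj₂ refl with trans (sym (odd%2 j)) n%2≡0
... | ()

halve-odd : ∀ n → n % 2 ≡ 1 → ∃ λ j → n ≡ 1 + j * 2
halve-odd n n%2≡1 with halve n
... | j , inj₂ n≡   = j , n≡
... | j , inj₁ refl with trans (sym (even%2 j)) n%2≡1
... | ()

odd-factorˡ : ∀ x y → (x * y) % 2 ≡ 1 → x % 2 ≡ 1
odd-factorˡ x y odd with halve x
... | j , inj₂ refl = odd%2 j
... | j , inj₁ refl with trans (sym (trans (cong (_% 2) (regroup j y)) (even%2 (j * y)))) odd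
  where
  regroup : ∀ j y → j * 2 * y ≡ j * y * 2
  regroup = solve-∀ᴺ
... | ()

odd-factorʳ : ∀ x y → (x * y) % 2 ≡ 1 → y % 2 ≡ 1
odd-factorʳ x y odd = odd-factorˡ y x (trans (cong (_% 2) (ℕ.*-comm y x)) odd)

-- The second factor on the right is odd, so an odd x would make an even number odd.
even-factor : ∀ x j {L} → + 2 *ᶻ L ≡ + x *ᶻ (+ (j * 2) +ᶻ + 1) → x % 2 ≡ 0
even-factor x j {L} eq with halve x
... | i , inj₁ refl = even%2 i
... | i , inj₂ refl = ⊥-elim (odd≢even (i + j + i * j * 2) ∣ L ∣ (begin
  1 + (i + j + i * j * 2) * 2                  ≡⟨ expand i j ⟩
  (1 + i * 2) * (j * 2 + 1)                    ≡⟨ ℤ.abs-* (+ (1 + i * 2)) (+ (j * 2 + 1)) ⟨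
  ∣ + (1 + i * 2) *ᶻ + (j * 2 + 1) ∣            ≡⟨ cong ∣_∣ eq ⟨
  ∣ + 2 *ᶻ L ∣                                  ≡⟨ ℤ.abs-* (+ 2) L ⟩
  2 * ∣ L ∣                                     ≡⟨ ℕ.*-comm 2 ∣ L ∣ ⟩
  ∣ L ∣ * 2                                     ∎))
  where
  open ≡-Reasoning
  expand : ∀ i j → 1 + (i + j + i * j * 2) * 2 ≡ (1 + i * 2) * (j * 2 + 1)
  expand = solve-∀ᴺ

-- Choice of the rectangles by parity, and the equivalence

magicSet-even-even : ∀ c m n → m % 2 ≡ 0 → n % 2 ≡ 0 → 4 ≤ n → MagicSet c m n
magicSet-even-even c m n m-even n-even 4≤n with halve-even m m-even | halve-even n n-even
... | U , refl | V , refl with halve V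
... | k , inj₁ refl = subst (MagicSet c (U * 2)) (sym (ℕ.*-assoc k 2 2)) (magicSet-4∣n c U k)
... | suc k , inj₂ refl = subst (MagicSet c (U * 2)) (cong (λ z → 6 + z) (sym (ℕ.*-assoc k 2 2))) (magicSet-4∣n+2 c U k)
magicSet-even-even c m n m-even n-even (s≤s (s≤s ())) | U , refl | V , refl | zero , inj₂ refl

magicSet-odd-odd : ∀ c m n → c % 2 ≡ 1 → m % 2 ≡ 1 → n % 2 ≡ 1 → 2 ≤ m → 4 ≤ n → MagicSet c m n
magicSet-odd-odd c m n c-odd m-odd n-odd 2≤m 4≤n with halve-odd c c-odd | halve-odd m m-odd | halve-odd n n-odd
... | C , refl | suc M , refl | suc (suc Q) , refl = magicSet-odd C M (suc Q) (s≤s z≤n)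
magicSet-odd-odd c m n c-odd m-odd n-odd (s≤s ()) 4≤n | C , refl | zero , refl | _ , refl
magicSet-odd-odd c m n c-odd m-odd n-odd 2≤m (s≤s ()) | C , refl | suc M , refl | zero , refl
magicSet-odd-odd c m n c-odd m-odd n-odd 2≤m (s≤s (s≤s (s≤s ()))) | C , refl | suc M , refl | suc zero , refl

theorem11 : (a b m n p q : ℕ) → a ≥ 1 → b ≥ 1 → m > 1 → p > 1 → q > 1 → n ≥ 4 →
    DistanceMagic ((a · H m p) ⊠ (b · H n q)) ⇔
    ((m % 2 ≡ 0 × n % 2 ≡ 0) ⊎ (m * n * a * b * p * q) % 2 ≡ 1)
theorem11 (suc a) (suc b) (suc (suc m)) (suc (suc (suc (suc n)))) (suc (suc p)) (suc (suc q))
          (s≤s _) (s≤s _) (s≤s (s≤s _)) (s≤s (s≤s _)) (s≤s (s≤s _)) 4≤n@(s≤s (s≤s (s≤s (s≤s _)))) =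
  mk⇔ necessary sufficient
  where
  a′ = suc a
  b′ = suc b
  m′ = 2 + m
  n′ = 4 + n
  p′ = 2 + p
  q′ = 2 + q
  G = a′ · H m′ p′ ⊠ b′ · H n′ q′
  order≡ : ∀ a b m n p q → a * (p * m) * (b * (q * n)) ≡ m * n * a * b * p * q
  order≡ = solve-∀ᴺ
  -- mn - m - n vanishes only for m = n = 2.
  D≡ : + m′ *ᶻ + n′ -ᶻ + n′ -ᶻ + m′ ≡ + suc (1 + (3 * m + n + m * n))
  D≡ = trans (ring (+ m) (+ n)) (cong₂ (λ x y → + 2 +ᶻ (x +ᶻ + n +ᶻ y)) (sym (ℤ.pos-* 3 m)) (sym (ℤ.pos-* m n)))
    where
    ring : ∀ m n → (+ 2 +ᶻ m) *ᶻ (+ 4 +ᶻ n) -ᶻ (+ 4 +ᶻ n) -ᶻ (+ 2 +ᶻ m) ≡ + 2 +ᶻ (+ 3 *ᶻ m +ᶻ n +ᶻ m *ᶻ n)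
    ring = solve-∀
  necessary : DistanceMagic G → (m′ % 2 ≡ 0 × n′ % 2 ≡ 0) ⊎ (m′ * n′ * a′ * b′ * p′ * q′) % 2 ≡ 1
  necessary magic = parities (line-sums D≡ magic) (halve (order G))
    where
    parities : (∃ λ R → + 2 *ᶻ R ≡ + n′ *ᶻ (+ order G +ᶻ + 1)) × (∃ λ C → + 2 *ᶻ C ≡ + m′ *ᶻ (+ order G +ᶻ + 1)) →
               (∃ λ j → order G ≡ j * 2 ⊎ order G ≡ 1 + j * 2) →
               (m′ % 2 ≡ 0 × n′ % 2 ≡ 0) ⊎ (m′ * n′ * a′ * b′ * p′ * q′) % 2 ≡ 1
    -- The order is mnabpq, so an odd order is the second alternative itself; for an even order the
    -- line sums force m and n to be even.
    parities _ (j , inj₂ odd) =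
      inj₂ (trans (cong (_% 2) (trans (sym (order≡ a′ b′ m′ n′ p′ q′)) odd)) (odd%2 j))
    parities ((_ , rows) , (_ , cols)) (j , inj₁ even) =
      inj₁ ( even-factor m′ j (trans cols (cong (λ N → + m′ *ᶻ (+ N +ᶻ + 1)) even))
           , even-factor n′ j (trans rows (cong (λ N → + n′ *ᶻ (+ N +ᶻ + 1)) even)))
  sufficient : (m′ % 2 ≡ 0 × n′ % 2 ≡ 0) ⊎ (m′ * n′ * a′ * b′ * p′ * q′) % 2 ≡ 1 → DistanceMagic G
  sufficient parity = magicSet⇒distanceMagic a′ b′ m′ n′ p′ q′ (rectangles parity)
                        ((zero , zero , zero) , (zero , zero , zero))
    where
    c = a′ * p′ * (b′ * q′)
    regroup : ∀ a b m n p q → m * n * a * b * p * q ≡ a * p * (b * q) * (m * n)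
    regroup = solve-∀ᴺ
    rectangles : (m′ % 2 ≡ 0 × n′ % 2 ≡ 0) ⊎ (m′ * n′ * a′ * b′ * p′ * q′) % 2 ≡ 1 → MagicSet c m′ n′
    rectangles (inj₁ (m-even , n-even)) = magicSet-even-even c m′ n′ m-even n-even 4≤n
    rectangles (inj₂ odd) = magicSet-odd-odd c m′ n′ (odd-factorˡ c (m′ * n′) odd′)
      (odd-factorˡ m′ n′ mn-odd) (odd-factorʳ m′ n′ mn-odd) (s≤s (s≤s z≤n)) 4≤n
      where
      odd′ : (c * (m′ * n′)) % 2 ≡ 1
      odd′ = trans (cong (_% 2) (sym (regroup a′ b′ m′ n′ p′ q′))) odd
      mn-odd : (m′ * n′) % 2 ≡ 1
      mn-odd = odd-factorʳ c (m′ * n′) odd′
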